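{- There exists a (randomized) streaming algorithm that, given $n$ coins arriving one by one in a stream in arbitrary order, with gap parameter $\Delta>0$ and confidence parameter $\delta\in(0,1)$, finds the most biased coin with probability at least $1-\delta$ using $O\!\left(\frac{n}{\Delta^2}\cdot\log(1/\delta)\right)$ coin tosses and a memory of $O(\log\log(n))$ coins.
   Context: Streaming coin tossing. There are $n$ coins with unknown biases $p_1,\dots,p_n\in[0,1]$; each toss of the $i$-th coin is an independent Bernoulli$(p_i)$ random variable. The gap parameter $\Delta$ is the difference between the largest bias and the second largest bias; it is assumed that $\Delta>0$ (so the most biased coin is unique) and that $n,\Delta,\delta$ are known to the algorithm. The coins arrive one by one in a stream. At any time the algorithm may toss only the currently arriving coin or a coin explicitly stored in its memory; a coin that is not stored, or that is removed from memory, can no longer be tossed or recovered. The memory of the algorithm is the maximum number of coins it stores at any point (auxiliary information such as counters is not counted). "Finds the most biased coin" means that at the end of the stream the algorithm outputs the coin with the largest bias. $O(\cdot)$ hides absolute constants, and $\log\log(n)$ is understood as at least $1$ in the memory bound. -}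

module Defs where

open import Algebra.Bundles using (CommutativeRing; Semiring)
import Algebra.Definitions.RawSemiring as RawSemiringDefs
import Algebra.Solver.Ring.NaturalCoefficients.Default as NatSolver
open import Data.Bool.Base using (Bool; true; false)
open import Data.Fin.Base using (Fin; toℕ)
open import Data.Fin.Properties using (_≟_)
open import Data.Fin.Subset using (Subset; ⊥; ⁅_⁆; _∪_; _∈_; ∣_∣) renaming (_-_ to _∖_)
open import Data.Nat.Base as ℕ using (ℕ; zero; suc; _⊔_)
import Data.Nat.Properties as ℕ
open import Data.Product.Base using (∃-syntax; _×_; _,_; proj₁; proj₂)
open import Data.Sum.Base using (_⊎_; inj₁; inj₂)
import Data.Vec.Functional as Vector
open import Function.Base using (_∘_)
open import Level using () renaming (suc to lsuc; _⊔_ to _l⊔_)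
open import Relation.Binary.Core using (Rel)
open import Relation.Binary.PropositionalEquality as ≡ using (_≡_; _≢_)
import Relation.Binary.Reasoning.Setoid as ≈-Reasoning
open import Relation.Binary.Structures using (IsStrictPartialOrder)
open import Relation.Nullary.Decidable.Core using (yes; no)
open import Relation.Nullary.Negation.Core using (¬_; contradiction)

-- The real numbers, given axiomatically as a Cauchy-complete Archimedean
-- ordered field.  The axioms are phrased so that they hold constructively
-- (for instance for Bishop's reals); classically ℝ is the only model.
record Reals c ℓ₁ ℓ₂ : Set (lsuc (c l⊔ ℓ₁ l⊔ ℓ₂)) where
  infix 4 _<_ _≤_
  field
    commutativeRing : CommutativeRing c ℓ₁

  open CommutativeRing commutativeRing public
    renaming (Carrier to ℝ)
  open RawSemiringDefs (Semiring.rawSemiring semiring) public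
    using (_^_; sum) renaming (_×_ to _·_)

  field
    _<_                  : Rel ℝ ℓ₂
    isStrictPartialOrder : IsStrictPartialOrder _≈_ _<_

  -- The usual order: with a strict order that need not be decidable, x ≤ y
  -- is the negation of y < x, not the disjunction x < y or x ≈ y.
  _≤_ : Rel ℝ ℓ₂
  x ≤ y = ¬ (y < x)

  fromℕ : ℕ → ℝ
  fromℕ n = n · 1#

  Cauchy : (ℕ → ℝ) → Set (c l⊔ ℓ₂)
  Cauchy a = ∀ ε → 0# < ε →
    ∃[ N ] (∀ m n → N ℕ.≤ m → N ℕ.≤ n → a m < a n + ε)

  ConvergesTo : (ℕ → ℝ) → ℝ → Set (c l⊔ ℓ₂)
  ConvergesTo a l = ∀ ε → 0# < ε →
    ∃[ N ] (∀ n → N ℕ.≤ n → a n < l + ε × l < a n + ε)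

  field
    <-cotrans   : ∀ {x y} → x < y → ∀ z → (x < z) ⊎ (z < y)
    ≤-antisym   : ∀ {x y} → x ≤ y → y ≤ x → x ≈ y
    0<1         : 0# < 1#
    +-monoʳ-<   : ∀ z {x y} → x < y → z + x < z + y
    *-pos       : ∀ {x y} → 0# < x → 0# < y → 0# < x * y
    inv         : ∀ x → 0# < x → ℝ
    inv-pos     : ∀ x (0<x : 0# < x) → 0# < inv x 0<x
    *-inverseʳ  : ∀ x (0<x : 0# < x) → x * inv x 0<x ≈ 1#
    archimedean : ∀ x → ∃[ n ] (x < fromℕ n)
    complete    : ∀ a → Cauchy a → ∃[ l ] (ConvergesTo a l)

  open IsStrictPartialOrder isStrictPartialOrder public
    using (<-respʳ-≈; <-respˡ-≈)
    renaming (irrefl to <-irrefl; trans to <-trans)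

module RealProperties {c ℓ₁ ℓ₂} (R : Reals c ℓ₁ ℓ₂) where
  open Reals R
  private
    module S = NatSolver commutativeSemiring

  <-resp : ∀ {x x′ y y′} → x ≈ x′ → y ≈ y′ → x < y → x′ < y′
  <-resp x≈ y≈ = <-respˡ-≈ x≈ ∘ <-respʳ-≈ y≈

  ≤-resp : ∀ {x x′ y y′} → x ≈ x′ → y ≈ y′ → x ≤ y → x′ ≤ y′
  ≤-resp x≈ y≈ x≤y y<x = x≤y (<-resp (sym y≈) (sym x≈) y<x)

  <⇒≤ : ∀ {x y} → x < y → x ≤ y
  <⇒≤ x<y y<x = <-irrefl refl (<-trans x<y y<x)

  ≤-refl : ∀ {x} → x ≤ x
  ≤-refl = <-irrefl refl

  <-≤-trans : ∀ {x y z} → x < y → y ≤ z → x < z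
  <-≤-trans x<y y≤z with <-cotrans x<y _
  ... | inj₁ x<z = x<z
  ... | inj₂ z<y = contradiction z<y y≤z

  ≤-<-trans : ∀ {x y z} → x ≤ y → y < z → x < z
  ≤-<-trans x≤y y<z with <-cotrans y<z _
  ... | inj₁ y<x = contradiction y<x x≤y
  ... | inj₂ x<z = x<z

  ≤-trans : ∀ {x y z} → x ≤ y → y ≤ z → x ≤ z
  ≤-trans x≤y y≤z z<x = y≤z (<-≤-trans z<x x≤y)

  -x+[x+y]≈y : ∀ x y → - x + (x + y) ≈ y
  -x+[x+y]≈y x y =
    trans (sym (+-assoc (- x) x y)) (trans (+-congʳ (-‿inverseˡ x)) (+-identityˡ y))

  +-monoʳ-≤ : ∀ z {x y} → x ≤ y → z + x ≤ z + y
  +-monoʳ-≤ z x≤y p =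
    x≤y (<-resp (-x+[x+y]≈y z _) (-x+[x+y]≈y z _) (+-monoʳ-< (- z) p))

  x<x+y : ∀ {x y} → 0# < y → x < x + y
  x<x+y 0<y = <-respˡ-≈ (+-identityʳ _) (+-monoʳ-< _ 0<y)

  x<y⇒0<y-x : ∀ {x y} → x < y → 0# < y - x
  x<y⇒0<y-x {x} x<y = <-resp (-‿inverseˡ x) (+-comm _ _) (+-monoʳ-< (- x) x<y)

  x+[y-x]≈y : ∀ x y → x + (y - x) ≈ y
  x+[y-x]≈y x y = trans (+-congˡ (+-comm y (- x)))
    (trans (sym (+-assoc x (- x) y)) (trans (+-congʳ (-‿inverseʳ x)) (+-identityˡ y)))

  *-monoʳ-< : ∀ {z} → 0# < z → ∀ {x y} → x < y → z * x < z * y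
  *-monoʳ-< {z} 0<z {x} {y} x<y = <-resp refl
    (trans (sym (distribˡ z x (y - x))) (*-congˡ (x+[y-x]≈y x y)))
    (x<x+y (*-pos 0<z (x<y⇒0<y-x x<y)))

  *-cancelˡ-< : ∀ {z} → 0# < z → ∀ {x y} → z * x < z * y → x < y
  *-cancelˡ-< {z} 0<z = <-resp (cancel _) (cancel _) ∘ *-monoʳ-< (inv-pos z 0<z)
    where
    cancel : ∀ x → inv z 0<z * (z * x) ≈ x
    cancel x = trans (sym (*-assoc _ z x))
      (trans (*-congʳ (trans (*-comm _ z) (*-inverseʳ z 0<z))) (*-identityˡ x))

  *-monoʳ-≤ : ∀ {z} → 0# < z → ∀ {x y} → x ≤ y → z * x ≤ z * y
  *-monoʳ-≤ 0<z x≤y = x≤y ∘ *-cancelˡ-< 0<z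

  ^-pos : ∀ {x} → 0# < x → ∀ n → 0# < x ^ n
  ^-pos 0<x zero    = 0<1
  ^-pos 0<x (suc n) = *-pos 0<x (^-pos 0<x n)

  fromℕ-suc-< : ∀ n → fromℕ n < fromℕ (suc n)
  fromℕ-suc-< n = <-respʳ-≈ (+-comm _ _) (x<x+y 0<1)

  fromℕ-mono-≤ : ∀ {m n} → m ℕ.≤ n → fromℕ m ≤ fromℕ n
  fromℕ-mono-≤ {n = zero}  ℕ.z≤n       = ≤-refl
  fromℕ-mono-≤ {n = suc n} ℕ.z≤n       =
    ≤-trans (fromℕ-mono-≤ {n = n} ℕ.z≤n) (<⇒≤ (fromℕ-suc-< n))
  fromℕ-mono-≤             (ℕ.s≤s m≤n) = +-monoʳ-≤ 1# (fromℕ-mono-≤ m≤n)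

  0<fromℕ-suc : ∀ n → 0# < fromℕ (suc n)
  0<fromℕ-suc n = ≤-<-trans (fromℕ-mono-≤ {n = n} ℕ.z≤n) (fromℕ-suc-< n)

  1/suc : ℕ → ℝ
  1/suc n = inv (fromℕ (suc n)) (0<fromℕ-suc n)

  0<1/suc : ∀ n → 0# < 1/suc n
  0<1/suc n = inv-pos _ (0<fromℕ-suc n)

  inv-antitone : ∀ {x y} (0<x : 0# < x) (0<y : 0# < y) → x ≤ y → inv y 0<y ≤ inv x 0<x
  inv-antitone {x} {y} 0<x 0<y x≤y p = x≤y (<-resp
    (begin
      x * y * inv x 0<x    ≈⟨ S.solve 3 (λ x y i → x :* y :* i := y :* (x :* i)) refl x y _ ⟩
      y * (x * inv x 0<x)  ≈⟨ *-congˡ (*-inverseʳ x 0<x) ⟩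
      y * 1#               ≈⟨ *-identityʳ y ⟩
      y                    ∎)
    (begin
      x * y * inv y 0<y    ≈⟨ *-assoc x y _ ⟩
      x * (y * inv y 0<y)  ≈⟨ *-congˡ (*-inverseʳ y 0<y) ⟩
      x * 1#               ≈⟨ *-identityʳ x ⟩
      x                    ∎)
    (*-monoʳ-< (*-pos 0<x 0<y) p))
    where
    open ≈-Reasoning setoid
    open S using (_:*_; _:=_)

module Logarithm {c ℓ₁ ℓ₂} (R : Reals c ℓ₁ ℓ₂) where
  open Reals R
  open RealProperties R
  private
    module S = NatSolver commutativeSemiring

  -- mercator x K = Σ_{k=1}^{K} xᵏ / k, a partial sum of the series of - log (1 - x).
  mercator : ℝ → ℕ → ℝ
  mercator x zero    = 0#
  mercator x (suc k) = mercator x k + x ^ suc k * 1/suc k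

  module _ {δ : ℝ} (0<δ : 0# < δ) (δ<1 : δ < 1#) where

    private
      x : ℝ
      x = 1# - δ

      0<x : 0# < x
      0<x = x<y⇒0<y-x δ<1

      x+δ≈1 : x + δ ≈ 1#
      x+δ≈1 = trans (+-comm x δ) (x+[y-x]≈y δ 1#)

      x<1 : x < 1#
      x<1 = <-respʳ-≈ x+δ≈1 (x<x+y 0<δ)

      L : ℕ → ℝ
      L = mercator x

      x^n≤1 : ∀ n → x ^ n ≤ 1#
      x^n≤1 zero    = ≤-refl
      x^n≤1 (suc n) =
        ≤-trans (*-monoʳ-≤ 0<x (x^n≤1 n)) (≤-resp (sym (*-identityʳ x)) refl (<⇒≤ x<1))

      L-increasing : ∀ d n → L n ≤ L (d ℕ.+ n)
      L-increasing zero    n = ≤-refl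
      L-increasing (suc d) n = ≤-trans (L-increasing d n)
        (<⇒≤ (x<x+y (*-pos (^-pos 0<x (suc (d ℕ.+ n))) (0<1/suc (d ℕ.+ n)))))

      1/suc-antitone : ∀ d n → 1/suc (d ℕ.+ n) ≤ 1/suc n
      1/suc-antitone d n = inv-antitone (0<fromℕ-suc n) (0<fromℕ-suc (d ℕ.+ n))
        (fromℕ-mono-≤ (ℕ.s≤s (ℕ.m≤n+m n d)))

      tail : ∀ d n → δ * L (d ℕ.+ n) + 1/suc n * x ^ suc (d ℕ.+ n)
                   ≤ δ * L n + 1/suc n * x ^ suc n
      tail zero    n = ≤-refl
      tail (suc d) n = ≤-trans step (tail d n)
        where
        open ≈-Reasoning setoid
        open S using (_:*_; _:+_; _:=_)
        k = d ℕ.+ n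
        Q = x ^ suc k
        r = 1/suc n
        step : δ * (L k + Q * 1/suc k) + r * (x * Q) ≤ δ * L k + r * Q
        step = ≤-resp
          (S.solve 6 (λ δ l Q s r x →
            (δ :* l :+ r :* (x :* Q)) :+ (δ :* Q) :* s :=
            δ :* (l :+ Q :* s) :+ r :* (x :* Q)) refl δ (L k) Q (1/suc k) r x)
          (begin
            (δ * L k + r * (x * Q)) + (δ * Q) * r
              ≈⟨ S.solve 5 (λ δ l Q r x →
                   (δ :* l :+ r :* (x :* Q)) :+ (δ :* Q) :* r :=
                   δ :* l :+ r :* ((x :+ δ) :* Q)) refl δ (L k) Q r x ⟩
            δ * L k + r * ((x + δ) * Q)
              ≈⟨ +-congˡ (*-congˡ (trans (*-congʳ x+δ≈1) (*-identityˡ Q))) ⟩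
            δ * L k + r * Q ∎)
          (+-monoʳ-≤ (δ * L k + r * (x * Q))
            (*-monoʳ-≤ (*-pos 0<δ (^-pos 0<x (suc k))) (1/suc-antitone d n)))

      tail′ : ∀ d n → δ * L (d ℕ.+ n) ≤ δ * L n + 1/suc n
      tail′ d n = ≤-trans
        (<⇒≤ (x<x+y (*-pos (0<1/suc n) (^-pos 0<x (suc (d ℕ.+ n))))))
        (≤-trans (tail d n)
          (+-monoʳ-≤ (δ * L n)
            (≤-resp refl (*-identityʳ _) (*-monoʳ-≤ (0<1/suc n) (x^n≤1 (suc n))))))

      L-cauchy : Cauchy L
      L-cauchy ε 0<ε = N , λ m n _ N≤n → bound m n N≤n (ℕ.≤-total m n)
        where
        0<δε : 0# < δ * ε
        0<δε = *-pos 0<δ 0<ε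

        N : ℕ
        N = proj₁ (archimedean (inv (δ * ε) 0<δε))

        1/suc<δε : ∀ n → N ℕ.≤ n → 1/suc n < δ * ε
        1/suc<δε n N≤n = *-cancelˡ-< (0<fromℕ-suc n) (<-resp
          (trans (*-inverseʳ (δ * ε) 0<δε) (sym (*-inverseʳ _ (0<fromℕ-suc n))))
          (*-comm (δ * ε) _)
          (*-monoʳ-< 0<δε (<-≤-trans (proj₂ (archimedean (inv (δ * ε) 0<δε)))
            (fromℕ-mono-≤ (ℕ.m≤n⇒m≤1+n N≤n)))))

        bound : ∀ m n → N ℕ.≤ n → (m ℕ.≤ n) ⊎ (n ℕ.≤ m) → L m < L n + ε
        bound m n N≤n (inj₁ m≤n) = ≤-<-trans
          (≡.subst (λ k → L m ≤ L k) (ℕ.m∸n+n≡m m≤n) (L-increasing (n ℕ.∸ m) m))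
          (x<x+y 0<ε)
        bound m n N≤n (inj₂ n≤m) = *-cancelˡ-< 0<δ (<-respʳ-≈ (sym (distribˡ δ (L n) ε))
          (≤-<-trans
            (≡.subst (λ k → δ * L k ≤ δ * L n + 1/suc n) (ℕ.m∸n+n≡m n≤m) (tail′ (m ℕ.∸ n) n))
            (+-monoʳ-< (δ * L n) (1/suc<δε n N≤n))))

    -- log (1 / δ) = - log (1 - (1 - δ)) = Σ_{k≥1} (1 - δ)ᵏ / k, the natural logarithm.
    log1/ : ℝ
    log1/ = proj₁ (complete (mercator (1# - δ)) L-cauchy)

-- The coins are named by their position in the stream, which an adversary
-- chooses by choosing the biases p : Fin n → ℝ.

private
  variable
    n t : ℕ
    M   : Subset n

-- t counts the coins that have arrived, so the current one has position t - 1.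
Available : ℕ → Subset n → Fin n → Set
Available t M c = (suc (toℕ c) ≡ t) ⊎ (c ∈ M)

-- A randomized streaming algorithm, as a decision tree, in a state where t
-- coins have arrived and the coins in M are stored.  The tree records nothing
-- about the biases; its branches may depend on all results seen so far, which
-- reflects that only stored coins, and not other information, are charged for.
data Program (n : ℕ) : ℕ → Subset n → Set where
  next    : t ℕ.< n → Program n (suc t) M → Program n t M
  toss    : ∀ c → Available t M c → (Bool → Program n t M) → Program n t M
  -- a uniformly random element of a finite non-empty set
  random  : ∀ k → (Fin (suc k) → Program n t M) → Program n t M
  store   : ∀ c → Available t M c → Program n t (M ∪ ⁅ c ⁆) → Program n t M
  discard : ∀ c → Program n t (M ∖ c) → Program n t M
  output  : t ≡ n → ∀ c → Available t M c → Program n t M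

Algorithm : ℕ → Set
Algorithm n = Program n 0 ⊥

-- Both costs are worst-case, over all tosses and all internal randomness.

tosses : Program n t M → ℕ
tosses (next _ P)     = tosses P
tosses (toss _ _ P)   = suc (tosses (P true) ⊔ tosses (P false))
tosses (random k P)   = Vector.foldr _⊔_ 0 (λ i → tosses (P i))
tosses (store _ _ P)  = tosses P
tosses (discard _ P)  = tosses P
tosses (output _ _ _) = 0

memory : Program n t M → ℕ
memory {M = M} (next _ P)     = ∣ M ∣ ⊔ memory P
memory {M = M} (toss _ _ P)   = ∣ M ∣ ⊔ (memory (P true) ⊔ memory (P false))
memory {M = M} (random k P)   = ∣ M ∣ ⊔ Vector.foldr _⊔_ 0 (λ i → memory (P i))
memory {M = M} (store _ _ P)  = ∣ M ∣ ⊔ memory P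
memory {M = M} (discard _ P)  = ∣ M ∣ ⊔ memory P
memory {M = M} (output _ _ _) = ∣ M ∣

module CoinTossing {c ℓ₁ ℓ₂} (R : Reals c ℓ₁ ℓ₂) where
  open Reals R
  open RealProperties R using (1/suc)

  Biases : ℕ → Set c
  Biases n = Fin n → ℝ

  IsBiases : Biases n → Set ℓ₂
  IsBiases p = ∀ i → 0# ≤ p i × p i ≤ 1#

  record HasGap {n} (p : Biases n) (Δ : ℝ) : Set (ℓ₁ l⊔ ℓ₂) where
    field
      best second : Fin n
      best-max    : ∀ i → p i ≤ p best
      second≢best : second ≢ best
      second-max  : ∀ i → i ≢ best → p i ≤ p second
      gap         : p best - p second ≈ Δ

  Pr[_outputs_∣_] : Program n t M → Fin n → Biases n → ℝ
  Pr[ next _ P outputs b ∣ p ]     = Pr[ P outputs b ∣ p ]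
  Pr[ toss c _ P outputs b ∣ p ]   =
    p c * Pr[ P true outputs b ∣ p ] + (1# - p c) * Pr[ P false outputs b ∣ p ]
  Pr[ random k P outputs b ∣ p ]   = 1/suc k * sum (λ i → Pr[ P i outputs b ∣ p ])
  Pr[ store _ _ P outputs b ∣ p ]  = Pr[ P outputs b ∣ p ]
  Pr[ discard _ P outputs b ∣ p ]  = Pr[ P outputs b ∣ p ]
  Pr[ output _ c _ outputs b ∣ p ] with c ≟ b
  ... | yes _ = 1#
  ... | no  _ = 0#

{-# OPTIONS --safe #-}

-- The coins play a knockout tournament in the order of the stream.  In a duel of
-- strength j both coins are tossed s j times, where s ≈ 8 / Δ², and an exponential
-- moment bound shows that the best coin loses with probability at most 2⁻ʲ.  A
-- group of level ℓ + 1 consists of 1 + 2 ^ 2 ^ ℓ groups of level ℓ, whose winners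
-- meet in duels of strength k + ℓ + 1 + 2 ^ ℓ; only the winner so far is stored at
-- each level.  The union bound over all levels gives the error 2⁻ᵏ, the cost per
-- coin is O(k s) since the number of duels drops much faster with ℓ than their
-- strength grows, and log log n + O(1) levels suffice.
--
-- With 2⁻ᵏ < δ < 2²⁻ᵏ this is the claim, except that for δ → 1 the budget
-- log (1 / δ) ≈ 1 - δ does not even allow tossing every coin once.  In this case
-- only a random block of a fraction of order 1 - δ of the stream takes part.

module Submission where

open import Defs
import Algebra.Properties.CommutativeSemiring.Exp as Exp
import Algebra.Properties.Semiring.Mult as Mult
import Algebra.Solver.Ring.NaturalCoefficients.Default as NatSolver
open import Data.Bool.Base using (Bool; true; false)
open import Data.Fin.Base using (Fin; zero; suc; toℕ; fromℕ<)
open import Data.Fin.Properties using (toℕ-fromℕ<; toℕ-injective; toℕ<n; _≟_)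
open import Data.Fin.Subset
  using (Subset; ⊥; ⁅_⁆; _∪_; _∈_; _⊆_; ∣_∣; inside; outside) renaming (_-_ to _∖_)
open import Data.Fin.Subset.Properties
  using (∪-identityʳ; q⊆p∪q; p⊆p∪q; x∈⁅x⁆; x∈p∪q⁻; x∈⁅y⁆⇒x≡y; x∈p∧x≢y⇒x∈p-y;
         x∈p⇒∣p-x∣<∣p∣; p─q⊆p; ∉⊥; ∣⊥∣≡0)
open import Data.Nat.Base as ℕ using (ℕ; zero; suc; _⊔_; _⊓_; _<ᵇ_)
open import Data.Nat.DivMod using (m≡m%n+[m/n]*n; m%n<n; m/n*n≤m; m<n*o⇒m/o<n)
open import Data.Nat.Logarithm using (⌊log₂_⌋; ⌊log₂⌋-mono-≤; ⌊log₂[2^n]⌋≡n)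
import Data.Nat.Properties as ℕ
open import Data.Nat.Tactic.RingSolver using (solve-∀)
open import Data.Product.Base using (∃-syntax; Σ-syntax; _×_; _,_; proj₁; proj₂)
open import Data.Sum.Base using (_⊎_; inj₁; inj₂)
import Data.Vec.Functional as Vector
open import Data.Vec.Base using (_∷_)
open import Function.Base using (id; _∘_)
open import Level using () renaming (_⊔_ to _l⊔_)
open import Relation.Binary.Definitions using (Asymmetric; _Respects₂_)
open import Relation.Binary.PropositionalEquality as ≡ using (_≡_; _≢_)
import Relation.Binary.Reasoning.Base.Triple as Triple
open import Relation.Binary.Structures using (IsPreorder)
open import Relation.Nullary.Decidable.Core using (yes; no)
open import Relation.Nullary.Negation.Core using (¬_; contradiction)
open import Relation.Nullary.Reflects using (ofʸ; ofⁿ)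

-- Ordered field arithmetic

-- The order of the reals is not decidable, so neither `Δ` nor `δ` can be compared with a threshold.
-- Each case distinction uses cotransitivity with two overlapping alternatives instead (`1 < Δ` or
-- `Δ < 2`, `1/8 < 1 - δ` or `1 - δ < 1/4`), and `least-switch` turns a sequence of such
-- alternatives into a bounded search. This is where much of the slack in the constants comes from.
--
-- The toss bound has to hold for every `Δ > 0` and every `δ < 1`, also where it permits fewer than
-- one toss per coin. Hence a block of a single coin must cost nothing, and a gap above 1, which no
-- biases have, must lead to an algorithm without tosses.
--
-- The moment bound needs no exponential function: the base `1 + Δ / 2` and its inverse turn the
-- estimate of one round into a polynomial inequality, and Bernoulli's inequality gives the number
-- of rounds.

least-switch : ∀ {a b} {P : ℕ → Set a} {Q : ℕ → Set b} →
  P 0 → (∀ i → Q (suc i) ⊎ P (suc i)) → ∀ N → ¬ P N → ∃[ i ] (P i × Q (suc i))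
least-switch p₀ decide zero    ¬p = contradiction p₀ ¬p
least-switch {P = P} {Q} p₀ decide (suc N) ¬p with decide 0
... | inj₁ q = 0 , p₀ , q
... | inj₂ p with least-switch {P = P ∘ suc} {Q ∘ suc} p (decide ∘ suc) N ¬p
...   | i , pᵢ , q = suc i , pᵢ , q

module OrderedField {c ℓ₁ ℓ₂} (R : Reals c ℓ₁ ℓ₂) where
  open Reals R hiding (zero)
  open RealProperties R
  open Exp commutativeSemiring public using (^-homo-*; ^-assocʳ; ^-distrib-*; ^-congˡ)
  open Mult semiring using (×1-homo-*)

  module S = NatSolver commutativeSemiring
  open S using (Polynomial; _:*_; _:+_; _:=_; con)

  -- con k denotes k ×′ 1#, which is not definitionally fromℕ k.
  num : ∀ {k} → ℕ → Polynomial k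
  num zero    = con 0
  num (suc i) = con 1 :+ num i

  ≤-reflexive : ∀ {x y} → x ≈ y → x ≤ y
  ≤-reflexive x≈y = ≤-resp refl x≈y ≤-refl

  ≤-isPreorder : IsPreorder _≈_ _≤_
  ≤-isPreorder = record
    { isEquivalence = isEquivalence ; reflexive = ≤-reflexive ; trans = ≤-trans }

  <-asym : Asymmetric _<_
  <-asym x<y y<x = <⇒≤ x<y y<x

  <-resp-≈ : _<_ Respects₂ _≈_
  <-resp-≈ = <-respʳ-≈ , <-respˡ-≈

  module ≤-Reasoning = Triple {_≈_ = _≈_} {_≤_ = _≤_} {_<_ = _<_}
    ≤-isPreorder <-asym <-trans <-resp-≈ <⇒≤ <-≤-trans ≤-<-trans
  open ≤-Reasoning

  +-monoˡ-≤ : ∀ z {x y} → x ≤ y → x + z ≤ y + z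
  +-monoˡ-≤ z x≤y = ≤-resp (+-comm z _) (+-comm z _) (+-monoʳ-≤ z x≤y)

  +-mono-≤ : ∀ {x y u v} → x ≤ y → u ≤ v → x + u ≤ y + v
  +-mono-≤ {y = y} {u} x≤y u≤v = ≤-trans (+-monoˡ-≤ u x≤y) (+-monoʳ-≤ y u≤v)

  +-cancelˡ-≤ : ∀ z {x y} → z + x ≤ z + y → x ≤ y
  +-cancelˡ-≤ z {x} {y} le = ≤-resp (-x+[x+y]≈y z x) (-x+[x+y]≈y z y) (+-monoʳ-≤ (- z) le)

  x≤x+y : ∀ x {y} → 0# ≤ y → x ≤ x + y
  x≤x+y x 0≤y = ≤-resp (+-identityʳ x) refl (+-monoʳ-≤ x 0≤y)

  x≤y+x : ∀ x {y} → 0# ≤ y → x ≤ y + x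
  x≤y+x x 0≤y = ≤-resp refl (+-comm x _) (x≤x+y x 0≤y)

  0≤+ : ∀ {x y} → 0# ≤ x → 0# ≤ y → 0# ≤ x + y
  0≤+ 0≤x 0≤y = ≤-trans 0≤x (x≤x+y _ 0≤y)

  0≤1 : 0# ≤ 1#
  0≤1 = <⇒≤ 0<1

  x≤y⇒0≤y-x : ∀ {x y} → x ≤ y → 0# ≤ y - x
  x≤y⇒0≤y-x {x} x≤y = ≤-resp (-‿inverseʳ x) refl (+-monoˡ-≤ (- x) x≤y)

  -- Multiplying by z ≥ 0 has to be reduced to z > 0 and z ≈ 0 under a double
  -- negation, since the order is not decidable.
  *-monoʳ-≤′ : ∀ {z} → 0# ≤ z → ∀ {x y} → x ≤ y → z * x ≤ z * y
  *-monoʳ-≤′ {z} 0≤z {x} {y} x≤y zy<zx = <-irrefl zy≈zx zy<zx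
    where
    z≤0 : z ≤ 0#
    z≤0 0<z = *-monoʳ-≤ 0<z x≤y zy<zx
    zy≈zx : z * y ≈ z * x
    zy≈zx = trans (*-congʳ z≈0) (trans (zeroˡ y) (sym (trans (*-congʳ z≈0) (zeroˡ x))))
      where z≈0 = ≤-antisym z≤0 0≤z

  *-monoˡ-≤′ : ∀ {z} → 0# ≤ z → ∀ {x y} → x ≤ y → x * z ≤ y * z
  *-monoˡ-≤′ 0≤z x≤y = ≤-resp (*-comm _ _) (*-comm _ _) (*-monoʳ-≤′ 0≤z x≤y)

  *-mono-≤ : ∀ {x y u v} → 0# ≤ u → 0# ≤ y → x ≤ y → u ≤ v → x * u ≤ y * v
  *-mono-≤ 0≤u 0≤y x≤y u≤v = ≤-trans (*-monoˡ-≤′ 0≤u x≤y) (*-monoʳ-≤′ 0≤y u≤v)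

  *-cancelˡ-≤ : ∀ {z} → 0# < z → ∀ {x y} → z * x ≤ z * y → x ≤ y
  *-cancelˡ-≤ 0<z le y<x = le (*-monoʳ-< 0<z y<x)

  0≤* : ∀ {x y} → 0# ≤ x → 0# ≤ y → 0# ≤ x * y
  0≤* {x} 0≤x 0≤y = ≤-resp (zeroʳ x) refl (*-monoʳ-≤′ 0≤x 0≤y)

  0≤sum : ∀ {k} {f : Fin k → ℝ} → (∀ i → 0# ≤ f i) → 0# ≤ sum f
  0≤sum {zero}  0≤f = ≤-refl
  0≤sum {suc k} 0≤f = 0≤+ (0≤f zero) (0≤sum (0≤f ∘ suc))

  term≤sum : ∀ {k} {f : Fin k → ℝ} → (∀ i → 0# ≤ f i) → ∀ i → f i ≤ sum f
  term≤sum 0≤f zero    = x≤x+y _ (0≤sum (0≤f ∘ suc))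
  term≤sum 0≤f (suc i) = ≤-trans (term≤sum (0≤f ∘ suc) i) (x≤y+x _ (0≤f zero))

  0≤^ : ∀ {x} → 0# ≤ x → ∀ n → 0# ≤ x ^ n
  0≤^ 0≤x zero    = 0≤1
  0≤^ 0≤x (suc n) = 0≤* 0≤x (0≤^ 0≤x n)

  ^-mono-≤ : ∀ {x y} → 0# ≤ x → x ≤ y → ∀ n → x ^ n ≤ y ^ n
  ^-mono-≤ 0≤x x≤y zero    = ≤-refl
  ^-mono-≤ 0≤x x≤y (suc n) =
    *-mono-≤ (0≤^ 0≤x n) (≤-trans 0≤x x≤y) x≤y (^-mono-≤ 0≤x x≤y n)

  1^n≈1 : ∀ n → 1# ^ n ≈ 1#
  1^n≈1 zero    = refl
  1^n≈1 (suc n) = trans (*-identityˡ _) (1^n≈1 n)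

  1≤^ : ∀ {x} → 1# ≤ x → ∀ n → 1# ≤ x ^ n
  1≤^ 1≤x n = ≤-resp (1^n≈1 n) refl (^-mono-≤ 0≤1 1≤x n)

  0≤fromℕ : ∀ n → 0# ≤ fromℕ n
  0≤fromℕ n = fromℕ-mono-≤ {n = n} ℕ.z≤n

  bernoulli : ∀ {x} → 0# ≤ x → ∀ n → 1# + fromℕ n * x ≤ (1# + x) ^ n
  bernoulli {x} 0≤x zero    = ≤-reflexive (trans (+-congˡ (zeroˡ x)) (+-identityʳ 1#))
  bernoulli {x} 0≤x (suc n) = begin
    1# + (1# + N) * x
      ≤⟨ x≤x+y _ (0≤* (0≤fromℕ n) (0≤* 0≤x 0≤x)) ⟩
    1# + (1# + N) * x + N * (x * x)
      ≈⟨ S.solve 2 (λ x N → con 1 :+ (con 1 :+ N) :* x :+ N :* (x :* x) :=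
           (con 1 :+ x) :* (con 1 :+ N :* x)) refl x N ⟩
    (1# + x) * (1# + N * x)
      ≤⟨ *-monoʳ-≤′ (0≤+ 0≤1 0≤x) (bernoulli 0≤x n) ⟩
    (1# + x) * (1# + x) ^ n ∎
    where
    N = fromℕ n

  fromℕ-* : ∀ m n → fromℕ (m ℕ.* n) ≈ fromℕ m * fromℕ n
  fromℕ-* = ×1-homo-*

  fromℕ-^ : ∀ m n → fromℕ (m ℕ.^ n) ≈ fromℕ m ^ n
  fromℕ-^ m zero    = +-identityʳ 1#
  fromℕ-^ m (suc n) = trans (fromℕ-* m (m ℕ.^ n)) (*-congˡ (fromℕ-^ m n))

  ½ : ℝ
  ½ = 1/suc 1

  2*½≈1 : fromℕ 2 * ½ ≈ 1#
  2*½≈1 = *-inverseʳ _ _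

  0<½ : 0# < ½
  0<½ = 0<1/suc 1

  0≤½^ : ∀ n → 0# ≤ ½ ^ n
  0≤½^ = 0≤^ (<⇒≤ 0<½)

  2^n*½^n≈1 : ∀ n → fromℕ (2 ℕ.^ n) * ½ ^ n ≈ 1#
  2^n*½^n≈1 n = trans (*-congʳ (fromℕ-^ 2 n))
    (trans (sym (^-distrib-* (fromℕ 2) ½ n)) (trans (^-congˡ n 2*½≈1) (1^n≈1 n)))

  ½^-double : ∀ n → ½ ^ suc n + ½ ^ suc n ≈ ½ ^ n
  ½^-double n = trans
    (S.solve 2 (λ h x → h :* x :+ h :* x := (num 2 :* h) :* x) refl ½ (½ ^ n))
    (trans (*-congʳ 2*½≈1) (*-identityˡ _))

  ½+½≈1 : ½ + ½ ≈ 1#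
  ½+½≈1 = trans (S.solve 1 (λ h → h :+ h := num 2 :* h) refl ½) 2*½≈1

  ½≤1 : ½ ≤ 1#
  ½≤1 = ≤-resp refl ½+½≈1 (x≤x+y ½ (<⇒≤ 0<½))

  x*½+x*½≈x : ∀ x → x * ½ + x * ½ ≈ x
  x*½+x*½≈x x = trans (sym (distribˡ x ½ ½)) (trans (*-congˡ ½+½≈1) (*-identityʳ x))

  -- The margin between lo and hi makes the search decidable.
  multiple-between : ∀ {x lo hi} → 0# < x → 0# < hi → lo < hi →
    ∃[ N ] (fromℕ N * x < hi × lo < fromℕ (suc N) * x)
  multiple-between {x} {lo} {hi} 0<x 0<hi lo<hi =
    least-switch {P = λ N → fromℕ N * x < hi} {Q = λ N → lo < fromℕ N * x}
      (<-respˡ-≈ (sym (zeroˡ x)) 0<hi)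
      (λ i → <-cotrans lo<hi (fromℕ (suc i) * x))
      N (<⇒≤ hi<Nx)
    where
    N = proj₁ (archimedean (inv x 0<x * hi))
    hi<Nx : hi < fromℕ N * x
    hi<Nx = <-resp
      (trans (sym (*-assoc x _ hi)) (trans (*-congʳ (*-inverseʳ x 0<x)) (*-identityˡ hi)))
      (*-comm x _)
      (*-monoʳ-< 0<x (proj₂ (archimedean (inv x 0<x * hi))))

-- Knockout tournaments as streaming programs

∣p∪⁅x⁆∣≤1+∣p∣ : ∀ {n} (p : Subset n) (x : Fin n) → ∣ p ∪ ⁅ x ⁆ ∣ ℕ.≤ suc ∣ p ∣
∣p∪⁅x⁆∣≤1+∣p∣ (inside  ∷ p) zero    = ℕ.≤-trans
  (ℕ.≤-reflexive (≡.cong (suc ∘ ∣_∣) (∪-identityʳ p))) (ℕ.n≤1+n _)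
∣p∪⁅x⁆∣≤1+∣p∣ (outside ∷ p) zero    =
  ℕ.≤-reflexive (≡.cong (suc ∘ ∣_∣) (∪-identityʳ p))
∣p∪⁅x⁆∣≤1+∣p∣ (inside  ∷ p) (suc x) = ℕ.s≤s (∣p∪⁅x⁆∣≤1+∣p∣ p x)
∣p∪⁅x⁆∣≤1+∣p∣ (outside ∷ p) (suc x) = ∣p∪⁅x⁆∣≤1+∣p∣ p x

-- A knockout tournament among consecutive coins of the stream.  A duel of
-- strength j is designed to be lost by the best coin with probability ≤ 2⁻ʲ.
data Tournament : Set where
  leaf : Tournament
  duel : (strength : ℕ) (T U : Tournament) → Tournament

size : Tournament → ℕ
size leaf         = 1
size (duel _ T U) = size U ℕ.+ size T

cost : Tournament → ℕ
cost leaf         = 0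
cost (duel j T U) = cost U ℕ.+ cost T ℕ.+ j

-- The winner of T stays in memory while U is played.
space : Tournament → ℕ
space leaf         = 1
space (duel _ T U) = space T ⊔ suc (space U)

finish : Tournament → ℕ → ℕ
finish leaf         t = suc t
finish (duel _ T U) t = finish U (finish T t)

finish≡size+ : ∀ T t → finish T t ≡ size T ℕ.+ t
finish≡size+ leaf         t = ≡.refl
finish≡size+ (duel _ T U) t = ≡.trans (finish≡size+ U _)
  (≡.trans (≡.cong (size U ℕ.+_) (finish≡size+ T t)) (≡.sym (ℕ.+-assoc (size U) _ t)))

t≤finish : ∀ T {t} → t ℕ.≤ finish T t
t≤finish T {t} = ≡.subst (t ℕ.≤_) (≡.sym (finish≡size+ T t)) (ℕ.m≤n+m t _)

1≤space : ∀ T → 1 ℕ.≤ space T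
1≤space leaf         = ℕ.≤-refl
1≤space (duel _ T U) = ℕ.≤-trans (1≤space T) (ℕ.m≤m⊔n _ _)

module Play where

  private
    variable
      n t u : ℕ
      M M′  : Subset n

  -- This invariant separates the coins stored earlier from the two contestants of a later duel, so
  -- that discarding the loser cannot remove one of the former.
  Arrived : ℕ → Subset n → Set
  Arrived t M = ∀ {x} → x ∈ M → toℕ x ℕ.< t

  -- c, one of the coins that arrived at times t, …, u - 1, has been added to M.
  record Won (M : Subset n) (t u : ℕ) (c : Fin n) (M′ : Subset n) : Set where
    field
      t≤c     : t ℕ.≤ toℕ c
      c<u     : toℕ c ℕ.< u
      c∈M′    : c ∈ M′
      M⊆M′    : M ⊆ M′
      ∣M′∣≤   : ∣ M′ ∣ ℕ.≤ suc ∣ M ∣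
      arrived : Arrived u M′
  open Won

  won-leaf : ∀ (t<n : t ℕ.< n) → Arrived t M →
    Won M t (suc t) (fromℕ< t<n) (M ∪ ⁅ fromℕ< t<n ⁆)
  won-leaf {t} {M = M} t<n a = record
    { t≤c     = ℕ.≤-reflexive (≡.sym (toℕ-fromℕ< t<n))
    ; c<u     = ℕ.≤-reflexive (≡.cong suc (toℕ-fromℕ< t<n))
    ; c∈M′    = q⊆p∪q M _ (x∈⁅x⁆ _)
    ; M⊆M′    = p⊆p∪q _
    ; ∣M′∣≤   = ∣p∪⁅x⁆∣≤1+∣p∣ M _
    ; arrived = λ x∈ → new (x∈p∪q⁻ M _ x∈)
    }
    where
    new : ∀ {x} → (x ∈ M) ⊎ (x ∈ ⁅ fromℕ< t<n ⁆) → toℕ x ℕ.< suc t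
    new (inj₁ x∈M) = ℕ.m<n⇒m<1+n (a x∈M)
    new (inj₂ x∈c) = ℕ.≤-reflexive
      (≡.cong suc (≡.trans (≡.cong toℕ (x∈⁅y⁆⇒x≡y _ x∈c)) (toℕ-fromℕ< t<n)))

  module _ {v : ℕ} {c₁ c₂ : Fin n} {M₁ M₂ : Subset n}
    (a : Arrived t M) (w₁ : Won M t u c₁ M₁) (w₂ : Won M₁ u v c₂ M₂) where

    c₁<c₂ : toℕ c₁ ℕ.< toℕ c₂
    c₁<c₂ = ℕ.<-≤-trans (c<u w₁) (t≤c w₂)

    c₁≢c₂ : c₁ ≢ c₂
    c₁≢c₂ eq = ℕ.<⇒≢ c₁<c₂ (≡.cong toℕ eq)

    ∣M₂∣≤2+∣M∣ : ∣ M₂ ∣ ℕ.≤ 2 ℕ.+ ∣ M ∣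
    ∣M₂∣≤2+∣M∣ = ℕ.≤-trans (∣M′∣≤ w₂) (ℕ.s≤s (∣M′∣≤ w₁))

    private
      fresh : ∀ {x c} → x ∈ M → t ℕ.≤ toℕ c → x ≢ c
      fresh x∈M t≤c eq = ℕ.<⇒≢ (ℕ.<-≤-trans (a x∈M) t≤c) (≡.cong toℕ eq)

      t≤c₂ : t ℕ.≤ toℕ c₂
      t≤c₂ = ℕ.≤-trans (t≤c w₁) (ℕ.<⇒≤ c₁<c₂)

    won-first : Won M t v c₁ (M₂ ∖ c₂)
    won-first = record
      { t≤c     = t≤c w₁
      ; c<u     = ℕ.<-trans c₁<c₂ (c<u w₂)
      ; c∈M′    = x∈p∧x≢y⇒x∈p-y (M⊆M′ w₂ (c∈M′ w₁)) c₁≢c₂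
      ; M⊆M′    = λ x∈M → x∈p∧x≢y⇒x∈p-y (M⊆M′ w₂ (M⊆M′ w₁ x∈M)) (fresh x∈M t≤c₂)
      ; ∣M′∣≤   = ℕ.s≤s⁻¹ (ℕ.<-≤-trans (x∈p⇒∣p-x∣<∣p∣ (c∈M′ w₂)) ∣M₂∣≤2+∣M∣)
      ; arrived = arrived w₂ ∘ p─q⊆p M₂ _
      }

    won-second : Won M t v c₂ (M₂ ∖ c₁)
    won-second = record
      { t≤c     = t≤c₂
      ; c<u     = c<u w₂
      ; c∈M′    = x∈p∧x≢y⇒x∈p-y (c∈M′ w₂) (c₁≢c₂ ∘ ≡.sym)
      ; M⊆M′    = λ x∈M → x∈p∧x≢y⇒x∈p-y (M⊆M′ w₂ (M⊆M′ w₁ x∈M)) (fresh x∈M (t≤c w₁))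
      ; ∣M′∣≤   = ℕ.s≤s⁻¹ (ℕ.<-≤-trans (x∈p⇒∣p-x∣<∣p∣ (M⊆M′ w₂ (c∈M′ w₁))) ∣M₂∣≤2+∣M∣)
      ; arrived = arrived w₂ ∘ p─q⊆p M₂ _
      }

  count : Bool → ℕ → ℕ
  count true  = suc
  count false = id

  -- i and j are the numbers of heads of c₁ and c₂ so far.
  compete : ∀ {c₁ c₂} → Available t M c₁ → Available t M c₂ →
    (rounds i j : ℕ) → (Bool → Program n t M) → Program n t M
  compete a₁ a₂ zero    i j k = k (j <ᵇ i)
  compete a₁ a₂ (suc r) i j k = toss _ a₁ λ x → toss _ a₂ λ y →
    compete a₁ a₂ r (count x i) (count y j) k

  tosses-compete : ∀ {c₁ c₂} (a₁ : Available t M c₁) (a₂ : Available t M c₂) r i j {k x} →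
    (∀ b → tosses (k b) ℕ.≤ x) → tosses (compete a₁ a₂ r i j k) ℕ.≤ r ℕ.* 2 ℕ.+ x
  tosses-compete a₁ a₂ zero    i j k≤x = k≤x _
  tosses-compete a₁ a₂ (suc r) i j k≤x = ℕ.s≤s (ℕ.⊔-lub
    (ℕ.s≤s (ℕ.⊔-lub (tosses-compete a₁ a₂ r _ _ k≤x) (tosses-compete a₁ a₂ r _ _ k≤x)))
    (ℕ.s≤s (ℕ.⊔-lub (tosses-compete a₁ a₂ r _ _ k≤x) (tosses-compete a₁ a₂ r _ _ k≤x))))

  memory-compete : ∀ {c₁ c₂} (a₁ : Available t M c₁) (a₂ : Available t M c₂) r i j {k y} →
    ∣ M ∣ ℕ.≤ y → (∀ b → memory (k b) ℕ.≤ y) → memory (compete a₁ a₂ r i j k) ℕ.≤ y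
  memory-compete a₁ a₂ zero    i j M≤y k≤y = k≤y _
  memory-compete a₁ a₂ (suc r) i j {k} {y} M≤y k≤y = ℕ.⊔-lub M≤y (ℕ.⊔-lub
    (ℕ.⊔-lub M≤y (ℕ.⊔-lub (rest _ _) (rest _ _)))
    (ℕ.⊔-lub M≤y (ℕ.⊔-lub (rest _ _) (rest _ _))))
    where
    rest : ∀ i j → memory (compete a₁ a₂ r i j k) ℕ.≤ y
    rest i j = memory-compete a₁ a₂ r i j M≤y k≤y

  -- Programs have no sequencing, and the stored set after a group depends on its random winner.
  -- Groups are therefore played in continuation-passing style, with `Won` as the only knowledge
  -- about that set.
  Continuation : ℕ → Subset n → ℕ → Set
  Continuation {n} t M u = ∀ c {M′} → Won M t u c M′ → Program n u M′

  settle : ∀ {v c₁ c₂} {M₁ M₂ : Subset n} →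
    Arrived t M → Won M t u c₁ M₁ → Won M₁ u v c₂ M₂ → Continuation t M v →
    Bool → Program n v M₂
  settle a w₁ w₂ k true  = discard _ (k _ (won-first  a w₁ w₂))
  settle a w₁ w₂ k false = discard _ (k _ (won-second a w₁ w₂))

  module _ (s : ℕ) where

    play : ∀ T → Arrived t M → finish T t ℕ.≤ n → Continuation t M (finish T t) → Program n t M
    play leaf         a t<n k =
      next t<n (store _ (inj₁ (≡.cong suc (toℕ-fromℕ< t<n))) (k _ (won-leaf t<n a)))
    play (duel j T U) a u≤n k =
      play T a (ℕ.≤-trans (t≤finish U) u≤n) λ c₁ w₁ →
      play U (arrived w₁) u≤n λ c₂ w₂ →
      compete (inj₂ (M⊆M′ w₂ (c∈M′ w₁))) (inj₂ (c∈M′ w₂)) (s ℕ.* j) 0 0 (settle a w₁ w₂ k)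

    tosses-play : ∀ T (a : Arrived t M) (u≤n : finish T t ℕ.≤ n)
      {k : Continuation t M (finish T t)} {x} →
      (∀ c {M′} (w : Won M t (finish T t) c M′) → tosses (k c w) ℕ.≤ x) →
      tosses (play T a u≤n k) ℕ.≤ s ℕ.* cost T ℕ.* 2 ℕ.+ x
    tosses-play leaf         a u≤n {k} {x} k≤x =
      ℕ.≤-trans (k≤x _ _) (ℕ.m≤n+m x _)
    tosses-play (duel j T U) a u≤n {k} {x} k≤x = ℕ.≤-trans
      (tosses-play T a _ λ c₁ w₁ →
       tosses-play U (arrived w₁) u≤n λ c₂ w₂ →
       tosses-compete _ _ (s ℕ.* j) 0 0 λ where
         true  → k≤x _ _
         false → k≤x _ _)
      (ℕ.≤-reflexive (regroup s j (cost T) (cost U) x))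
      where
      regroup : ∀ s j p q x →
        s ℕ.* p ℕ.* 2 ℕ.+ (s ℕ.* q ℕ.* 2 ℕ.+ (s ℕ.* j ℕ.* 2 ℕ.+ x)) ≡
        s ℕ.* (q ℕ.+ p ℕ.+ j) ℕ.* 2 ℕ.+ x
      regroup = solve-∀

    memory-play : ∀ T (a : Arrived t M) (u≤n : finish T t ℕ.≤ n)
      {k : Continuation t M (finish T t)} {y} →
      ∣ M ∣ ℕ.+ space T ℕ.≤ y →
      (∀ c {M′} (w : Won M t (finish T t) c M′) → memory (k c w) ℕ.≤ y) →
      memory (play T a u≤n k) ℕ.≤ y
    memory-play leaf         a u≤n M≤y k≤y = ℕ.⊔-lub M≤ (ℕ.⊔-lub M≤ (k≤y _ _))
      where M≤ = ℕ.≤-trans (ℕ.m≤m+n _ 1) M≤y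
    memory-play {M = M} (duel j T U) a u≤n {k} {y} M≤y k≤y =
      memory-play T a _ (ℕ.≤-trans (ℕ.+-monoʳ-≤ ∣ M ∣ (ℕ.m≤m⊔n (space T) _)) M≤y) λ c₁ w₁ →
      memory-play U (arrived w₁) u≤n (U≤y w₁) λ c₂ w₂ →
      memory-compete _ _ (s ℕ.* j) 0 0 (M₂≤y w₁ w₂) λ where
        true  → ℕ.⊔-lub (M₂≤y w₁ w₂) (k≤y _ _)
        false → ℕ.⊔-lub (M₂≤y w₁ w₂) (k≤y _ _)
      where
      M+≤y : suc ∣ M ∣ ℕ.+ space U ℕ.≤ y
      M+≤y = ℕ.≤-trans (ℕ.≤-reflexive (≡.sym (ℕ.+-suc ∣ M ∣ (space U))))
        (ℕ.≤-trans (ℕ.+-monoʳ-≤ ∣ M ∣ (ℕ.m≤n⊔m (space T) _)) M≤y)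
      U≤y : ∀ {c₁ M₁ u} → Won M _ u c₁ M₁ → ∣ M₁ ∣ ℕ.+ space U ℕ.≤ y
      U≤y w₁ = ℕ.≤-trans (ℕ.+-monoˡ-≤ (space U) (∣M′∣≤ w₁)) M+≤y
      -- Both contestants are stored during the duel. The second one occupies a place that `U` had
      -- already, as `space U` is at least 1.
      M₂≤y : ∀ {c₁ c₂ M₁ M₂ u v} → Won M _ u c₁ M₁ → Won M₁ u v c₂ M₂ → ∣ M₂ ∣ ℕ.≤ y
      M₂≤y w₁ w₂ = ℕ.≤-trans (∣M₂∣≤2+∣M∣ a w₁ w₂) (ℕ.≤-trans
        (≡.subst (ℕ._≤ suc ∣ M ∣ ℕ.+ space U) (ℕ.+-comm (suc ∣ M ∣) 1)
          (ℕ.+-monoʳ-≤ (suc ∣ M ∣) (1≤space U))) M+≤y)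

  skip : ∀ d → d ℕ.+ t ℕ.≤ n → Program n (d ℕ.+ t) M → Program n t M
  skip zero    _  P = P
  skip (suc d) le P = skip d (ℕ.<⇒≤ le) (next le P)

  tosses-skip : ∀ d (le : d ℕ.+ t ℕ.≤ n) {P : Program n (d ℕ.+ t) M} →
    tosses (skip d le P) ≡ tosses P
  tosses-skip zero    le = ≡.refl
  tosses-skip (suc d) le = tosses-skip d (ℕ.<⇒≤ le)

  memory-skip : ∀ d (le : d ℕ.+ t ℕ.≤ n) {P : Program n (d ℕ.+ t) M} {y} →
    ∣ M ∣ ℕ.≤ y → memory P ℕ.≤ y → memory (skip d le P) ℕ.≤ y
  memory-skip zero    le M≤y P≤y = P≤y
  memory-skip (suc d) le M≤y P≤y = memory-skip d (ℕ.<⇒≤ le) M≤y (ℕ.⊔-lub M≤y P≤y)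

  module _ (s : ℕ) (start : ℕ) (T : Tournament) (u≤n : finish T (start ℕ.+ 0) ℕ.≤ n) where

    private
      -- The index `start + 0` is the time that `skip start` reaches from time 0.
      end = finish T (start ℕ.+ 0)

      rest : n ℕ.∸ end ℕ.+ end ≡ n
      rest = ℕ.m∸n+n≡m u≤n

      nothing-arrived : ∀ {t} → Arrived {n} t ⊥
      nothing-arrived x∈⊥ with () ← ∉⊥ x∈⊥

    announce : Continuation {n} (start ℕ.+ 0) ⊥ end
    announce c w = skip (n ℕ.∸ end) (ℕ.≤-reflexive rest) (output rest c (inj₂ (c∈M′ w)))

    tournamentAlgorithm : Algorithm n
    tournamentAlgorithm = skip start (ℕ.≤-trans (t≤finish T) u≤n)
      (play s T nothing-arrived u≤n announce)

    tosses-tournament : tosses tournamentAlgorithm ℕ.≤ s ℕ.* cost T ℕ.* 2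
    tosses-tournament = ℕ.≤-trans (ℕ.≤-reflexive (tosses-skip start _))
      (ℕ.≤-trans
        (tosses-play s T _ u≤n λ c w → ℕ.≤-reflexive (tosses-skip (n ℕ.∸ end) _))
        (ℕ.≤-reflexive (ℕ.+-identityʳ _)))

    memory-tournament : memory tournamentAlgorithm ℕ.≤ space T
    memory-tournament = memory-skip start _
      (ℕ.≤-trans (ℕ.≤-reflexive (∣⊥∣≡0 n)) ℕ.z≤n)
      (memory-play s T _ u≤n (ℕ.≤-reflexive (≡.cong (ℕ._+ space T) (∣⊥∣≡0 n))) λ c w →
        memory-skip (n ℕ.∸ end) _ (M≤ w) (M≤ w))
      where
      M≤ : ∀ {c M′} → Won ⊥ (start ℕ.+ 0) end c M′ → ∣ M′ ∣ ℕ.≤ space T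
      M≤ w = ℕ.≤-trans (∣M′∣≤ w)
        (ℕ.≤-trans (ℕ.≤-reflexive (≡.cong suc (∣⊥∣≡0 n))) (1≤space T))

open Play

-- Tournaments of doubly logarithmic depth

chain : ℕ → Tournament → ℕ → Tournament → Tournament
chain j F zero    T = T
chain j F (suc q) T = duel j (chain j F q T) F

module _ (j : ℕ) (F T : Tournament) where

  size-chain : ∀ q → size (chain j F q T) ≡ q ℕ.* size F ℕ.+ size T
  size-chain zero    = ≡.refl
  size-chain (suc q) = ≡.trans (≡.cong (size F ℕ.+_) (size-chain q))
    (≡.sym (ℕ.+-assoc (size F) _ _))

  cost-chain : ∀ q → cost (chain j F q T) ≡ q ℕ.* (cost F ℕ.+ j) ℕ.+ cost T
  cost-chain zero    = ≡.refl
  cost-chain (suc q) rewrite cost-chain q = regroup (cost F) (cost T) j (q ℕ.* (cost F ℕ.+ j))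
    where
    regroup : ∀ f t j x → f ℕ.+ (x ℕ.+ t) ℕ.+ j ≡ f ℕ.+ j ℕ.+ x ℕ.+ t
    regroup = solve-∀

  -- Chains nest to the left, so while any copy of `F` is played, only the winner so far is stored
  -- in addition. The number of copies does not enter.
  space-chain : ∀ q {y} → space F ℕ.≤ y → space T ℕ.≤ suc y → space (chain j F q T) ℕ.≤ suc y
  space-chain zero    F≤y T≤y = T≤y
  space-chain (suc q) F≤y T≤y = ℕ.⊔-lub (space-chain q F≤y T≤y) (ℕ.s≤s F≤y)

-- At level ℓ + 1 there are up to 1 + 2 ^ 2 ^ ℓ groups of level ℓ, so the number
-- of duels drops much faster with ℓ than their strength k + ℓ + 1 + 2 ^ ℓ grows.
width : ℕ → ℕ
width ℓ = 2 ℕ.^ (2 ℕ.^ ℓ)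

capacity : ℕ → ℕ
capacity zero    = 1
capacity (suc ℓ) = suc (width ℓ) ℕ.* capacity ℓ

capacity-nonZero : ∀ ℓ → ℕ.NonZero (capacity ℓ)
capacity-nonZero zero    = _
capacity-nonZero (suc ℓ) =
  ℕ.m*n≢0 (suc (width ℓ)) (capacity ℓ) {{_}} {{capacity-nonZero ℓ}}

quot rem : ℕ → ℕ → ℕ
quot ℓ i = ℕ._/_ i (capacity ℓ) {{capacity-nonZero ℓ}}
rem  ℓ i = ℕ._%_ i (capacity ℓ) {{capacity-nonZero ℓ}}

rem+quot : ∀ ℓ i → i ≡ rem ℓ i ℕ.+ quot ℓ i ℕ.* capacity ℓ
rem+quot ℓ i = m≡m%n+[m/n]*n i (capacity ℓ) {{capacity-nonZero ℓ}}

rem<capacity : ∀ ℓ i → rem ℓ i ℕ.< capacity ℓ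
rem<capacity ℓ i = m%n<n i (capacity ℓ) {{capacity-nonZero ℓ}}

quot≤width : ∀ ℓ {i} → i ℕ.< capacity (suc ℓ) → quot ℓ i ℕ.≤ width ℓ
quot≤width ℓ i<c =
  ℕ.s≤s⁻¹ (m<n*o⇒m/o<n {n = suc (width ℓ)} {{capacity-nonZero ℓ}} i<c)

module _ (k : ℕ) where

  -- The summand `2 ^ ℓ` compensates for the up to `width ℓ` duels that a coin may play at this
  -- level, as `width ℓ` times 2 to the power `- 2 ^ ℓ` is 1. The level then contributes the error 2
  -- to the power `- (k + ℓ + 1)`, and these errors sum to less than 2 to the power `- k`.
  strength : ℕ → ℕ
  strength ℓ = k ℕ.+ suc ℓ ℕ.+ 2 ℕ.^ ℓ

  full : ℕ → Tournament
  full zero    = leaf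
  full (suc ℓ) = chain (strength ℓ) (full ℓ) (width ℓ) (full ℓ)

  -- partial ℓ i has i + 1 leaves, if i < capacity ℓ.
  partial : ℕ → ℕ → Tournament
  partial zero    i = leaf
  partial (suc ℓ) i =
    chain (strength ℓ) (full ℓ) (quot ℓ i) (partial ℓ (rem ℓ i))

  size-full : ∀ ℓ → size (full ℓ) ≡ capacity ℓ
  size-full zero    = ≡.refl
  size-full (suc ℓ) = ≡.trans (size-chain (strength ℓ) (full ℓ) (full ℓ) (width ℓ))
    (≡.trans (ℕ.+-comm _ (size (full ℓ))) (≡.cong (suc (width ℓ) ℕ.*_) (size-full ℓ)))

  size-partial : ∀ ℓ {i} → i ℕ.< capacity ℓ → size (partial ℓ i) ≡ suc i
  size-partial zero    {zero}  i<c = ≡.refl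
  size-partial zero    {suc i} (ℕ.s≤s ())
  size-partial (suc ℓ) {i}     i<c = begin
    size (partial (suc ℓ) i)
      ≡⟨ size-chain (strength ℓ) (full ℓ) (partial ℓ r) q ⟩
    q ℕ.* size (full ℓ) ℕ.+ size (partial ℓ r)
      ≡⟨ ≡.cong₂ (λ x y → q ℕ.* x ℕ.+ y) (size-full ℓ) (size-partial ℓ (rem<capacity ℓ i)) ⟩
    q ℕ.* capacity ℓ ℕ.+ suc r
      ≡⟨ ℕ.+-suc _ r ⟩
    suc (q ℕ.* capacity ℓ ℕ.+ r)
      ≡⟨ ≡.cong suc (ℕ.+-comm _ r) ⟩
    suc (r ℕ.+ q ℕ.* capacity ℓ)
      ≡⟨ ≡.cong suc (rem+quot ℓ i) ⟨
    suc i ∎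
    where
    open ≡.≡-Reasoning
    q = quot ℓ i
    r = rem ℓ i

  strength-suc : ∀ ℓ → strength (suc ℓ) ℕ.≤ 2 ℕ.* strength ℓ
  strength-suc ℓ = ≡.subst (strength (suc ℓ) ℕ.≤_) (regroup k ℓ (2 ℕ.^ ℓ)) (ℕ.m≤m+n _ (k ℕ.+ ℓ))
    where
    regroup : ∀ k ℓ x → k ℕ.+ suc (suc ℓ) ℕ.+ 2 ℕ.* x ℕ.+ (k ℕ.+ ℓ) ≡ 2 ℕ.* (k ℕ.+ suc ℓ ℕ.+ x)
    regroup = solve-∀

  2≤width : ∀ ℓ → 2 ℕ.≤ width ℓ
  2≤width ℓ = ℕ.^-monoʳ-≤ 2 (ℕ.^-monoʳ-≤ 2 {0} {ℓ} ℕ.z≤n)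

  -- Forced by level 0 of `cost-full`: a leaf costs nothing, but its slack `2 * strength 0` has to
  -- fit into the budget of one coin.
  rate : ℕ
  rate = 2 ℕ.* strength 0

  -- The slack 2 * strength ℓ pays for the duels of the next level.
  cost-full : ∀ ℓ → cost (full ℓ) ℕ.+ 2 ℕ.* strength ℓ ℕ.≤ rate ℕ.* capacity ℓ
  cost-full zero    = ℕ.≤-reflexive (≡.sym (ℕ.*-identityʳ rate))
  cost-full (suc ℓ) = begin
    cost (full (suc ℓ)) ℕ.+ 2 ℕ.* j′
      ≡⟨ ≡.cong (ℕ._+ 2 ℕ.* j′) (cost-chain j (full ℓ) (full ℓ) w) ⟩
    w ℕ.* (f ℕ.+ j) ℕ.+ f ℕ.+ 2 ℕ.* j′
      ≤⟨ ℕ.+-monoʳ-≤ (w ℕ.* (f ℕ.+ j) ℕ.+ f) (ℕ.*-monoʳ-≤ 2 (strength-suc ℓ)) ⟩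
    w ℕ.* (f ℕ.+ j) ℕ.+ f ℕ.+ 2 ℕ.* (2 ℕ.* j)
      ≡⟨ regroup₁ w f j ⟩
    w ℕ.* (f ℕ.+ j) ℕ.+ f ℕ.+ 2 ℕ.* j ℕ.+ 2 ℕ.* j
      -- Of the slack `2 * j` of each of the `w + 1` groups, `w` groups spend one `j` on a duel.
      -- Their other `j`, at least `2 * j` in total, and the full slack of the remaining group make
      -- up the `4 * j` for the next level.
      ≤⟨ ℕ.+-monoʳ-≤ (w ℕ.* (f ℕ.+ j) ℕ.+ f ℕ.+ 2 ℕ.* j) (ℕ.*-monoˡ-≤ j (2≤width ℓ)) ⟩
    w ℕ.* (f ℕ.+ j) ℕ.+ f ℕ.+ 2 ℕ.* j ℕ.+ w ℕ.* j
      ≡⟨ regroup₂ w f j ⟩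
    suc w ℕ.* (f ℕ.+ 2 ℕ.* j)
      ≤⟨ ℕ.*-monoʳ-≤ (suc w) (cost-full ℓ) ⟩
    suc w ℕ.* (rate ℕ.* capacity ℓ)
      ≡⟨ regroup₃ w rate (capacity ℓ) ⟩
    rate ℕ.* capacity (suc ℓ) ∎
    where
    open ℕ.≤-Reasoning
    w  = width ℓ
    f  = cost (full ℓ)
    j  = strength ℓ
    j′ = strength (suc ℓ)
    regroup₁ : ∀ w f j → w ℕ.* (f ℕ.+ j) ℕ.+ f ℕ.+ 2 ℕ.* (2 ℕ.* j) ≡
                         w ℕ.* (f ℕ.+ j) ℕ.+ f ℕ.+ 2 ℕ.* j ℕ.+ 2 ℕ.* j
    regroup₁ = solve-∀
    regroup₂ : ∀ w f j → w ℕ.* (f ℕ.+ j) ℕ.+ f ℕ.+ 2 ℕ.* j ℕ.+ w ℕ.* j ≡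
                         suc w ℕ.* (f ℕ.+ 2 ℕ.* j)
    regroup₂ = solve-∀
    regroup₃ : ∀ w a c → suc w ℕ.* (a ℕ.* c) ≡ a ℕ.* (suc w ℕ.* c)
    regroup₃ = solve-∀

  -- The factor is `i`, not the number `i + 1` of leaves: one coin can be left uncharged, since a
  -- lone leaf plays no duel. This lets the costs of blocks scale down with their number, even to
  -- zero.
  cost-partial : ∀ ℓ i → cost (partial ℓ i) ℕ.≤ rate ℕ.* i
  cost-partial zero    i = ℕ.z≤n
  cost-partial (suc ℓ) i = begin
    cost (partial (suc ℓ) i)
      ≡⟨ cost-chain j (full ℓ) (partial ℓ r) q ⟩
    q ℕ.* (f ℕ.+ j) ℕ.+ cost (partial ℓ r)
      ≤⟨ ℕ.+-mono-≤ (ℕ.*-monoʳ-≤ q (ℕ.+-monoʳ-≤ f (ℕ.m≤m+n j (j ℕ.+ 0)))) (cost-partial ℓ r) ⟩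
    q ℕ.* (f ℕ.+ 2 ℕ.* j) ℕ.+ rate ℕ.* r
      ≤⟨ ℕ.+-monoˡ-≤ (rate ℕ.* r) (ℕ.*-monoʳ-≤ q (cost-full ℓ)) ⟩
    q ℕ.* (rate ℕ.* capacity ℓ) ℕ.+ rate ℕ.* r
      ≡⟨ regroup q rate (capacity ℓ) r ⟩
    rate ℕ.* (r ℕ.+ q ℕ.* capacity ℓ)
      ≡⟨ ≡.cong (rate ℕ.*_) (rem+quot ℓ i) ⟨
    rate ℕ.* i ∎
    where
    open ℕ.≤-Reasoning
    q = quot ℓ i
    r = rem ℓ i
    f = cost (full ℓ)
    j = strength ℓ
    regroup : ∀ q a c r → q ℕ.* (a ℕ.* c) ℕ.+ a ℕ.* r ≡ a ℕ.* (r ℕ.+ q ℕ.* c)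
    regroup = solve-∀

  space-full : ∀ ℓ → space (full ℓ) ℕ.≤ suc ℓ
  space-full zero    = ℕ.≤-refl
  space-full (suc ℓ) =
    space-chain (strength ℓ) (full ℓ) (full ℓ) (width ℓ) (space-full ℓ) (ℕ.m≤n⇒m≤1+n (space-full ℓ))

  space-partial : ∀ ℓ i → space (partial ℓ i) ℕ.≤ suc ℓ
  space-partial zero    i = ℕ.≤-refl
  space-partial (suc ℓ) i = space-chain (strength ℓ) (full ℓ) (partial ℓ (rem ℓ i)) (quot ℓ i)
    (space-full ℓ) (ℕ.m≤n⇒m≤1+n (space-partial ℓ (rem ℓ i)))

  rate≤6k : 1 ℕ.≤ k → rate ℕ.≤ 6 ℕ.* k
  rate≤6k 1≤k = begin
    2 ℕ.* (k ℕ.+ 1 ℕ.+ 1)  ≡⟨ regroup k ⟩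
    2 ℕ.* k ℕ.+ 4 ℕ.* 1    ≤⟨ ℕ.+-monoʳ-≤ (2 ℕ.* k) (ℕ.*-monoʳ-≤ 4 1≤k) ⟩
    2 ℕ.* k ℕ.+ 4 ℕ.* k    ≡⟨ ℕ.*-distribʳ-+ k 2 4 ⟨
    6 ℕ.* k                ∎
    where
    open ℕ.≤-Reasoning
    regroup : ∀ k → 2 ℕ.* (k ℕ.+ 1 ℕ.+ 1) ≡ 2 ℕ.* k ℕ.+ 4 ℕ.* 1
    regroup = solve-∀

n<2^[1+log₂n] : ∀ n → n ℕ.< 2 ℕ.^ suc ⌊log₂ n ⌋
n<2^[1+log₂n] n = ℕ.≰⇒> λ 2^≤n → ℕ.<-irrefl ≡.refl
  (≡.subst (ℕ._≤ ⌊log₂ n ⌋) (⌊log₂[2^n]⌋≡n (suc ⌊log₂ n ⌋)) (⌊log₂⌋-mono-≤ 2^≤n))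

levels : ℕ → ℕ
levels n = 2 ℕ.+ ⌊log₂ ⌊log₂ n ⌋ ⌋

n<capacity-levels : ∀ n → n ℕ.< capacity (levels n)
n<capacity-levels n = begin-strict
  n                            <⟨ n<2^[1+log₂n] n ⟩
  2 ℕ.^ suc ⌊log₂ n ⌋          ≤⟨ ℕ.^-monoʳ-≤ 2 (n<2^[1+log₂n] ⌊log₂ n ⌋) ⟩
  -- The number of groups at the top level alone exceeds `n`.
  width ℓ                      ≤⟨ ℕ.n≤1+n _ ⟩
  suc (width ℓ)                ≤⟨ ℕ.m≤m*n (suc (width ℓ)) (capacity ℓ) {{capacity-nonZero ℓ}} ⟩
  capacity (levels n)          ∎
  where
  open ℕ.≤-Reasoning
  ℓ = suc ⌊log₂ ⌊log₂ n ⌋ ⌋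

1+levels≤ : ∀ n → suc (levels n) ℕ.≤ 4 ℕ.* (1 ⊔ ⌊log₂ ⌊log₂ n ⌋ ⌋)
1+levels≤ n = bound ⌊log₂ ⌊log₂ n ⌋ ⌋
  where
  bound : ∀ x → 3 ℕ.+ x ℕ.≤ 4 ℕ.* (1 ⊔ x)
  bound x = ≡.subst (3 ℕ.+ x ℕ.≤_) (ℕ.+-comm (3 ℕ.* (1 ⊔ x)) _)
    (ℕ.+-mono-≤ (ℕ.*-monoʳ-≤ 3 (ℕ.m≤m⊔n 1 x)) (ℕ.m≤n⊔m 1 x))

-- The probability that the best coin wins

module ErrorBounds {c ℓ₁ ℓ₂} (R : Reals c ℓ₁ ℓ₂) where
  open Reals R hiding (zero)
  open RealProperties R
  open OrderedField R
  open ≤-Reasoning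
  open S using (_:*_; _:+_; _:=_; con)

  -- On every path from the root to a leaf the terms 2⁻ʲ sum up to at most f.
  data ErrorAtMost : Tournament → ℝ → Set (c l⊔ ℓ₂) where
    leaf : ∀ {f} → 0# ≤ f → ErrorAtMost leaf f
    duel : ∀ {j T U f} f′ → f′ + ½ ^ j ≤ f →
           ErrorAtMost T f′ → ErrorAtMost U f′ → ErrorAtMost (duel j T U) f

  error-mono : ∀ {T f g} → f ≤ g → ErrorAtMost T f → ErrorAtMost T g
  error-mono f≤g (leaf 0≤f)           = leaf (≤-trans 0≤f f≤g)
  error-mono f≤g (duel f′ f′+≤f eT eU) = duel f′ (≤-trans f′+≤f f≤g) eT eU

  error-chain : ∀ {j F T f} → ErrorAtMost F f → ErrorAtMost T f →
    ∀ q → ErrorAtMost (chain j F q T) (f + fromℕ q * ½ ^ j)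
  error-chain {j} {f = f} eF eT zero    =
    error-mono (≤-reflexive (sym (trans (+-congˡ (zeroˡ (½ ^ j))) (+-identityʳ f)))) eT
  error-chain {j} {f = f} eF eT (suc q) =
    duel (f + fromℕ q * ½ ^ j)
      (≤-reflexive (S.solve 3
        (λ f q h → f :+ q :* h :+ h := f :+ (con 1 :+ q) :* h) refl f (fromℕ q) (½ ^ j)))
      (error-chain eF eT q)
      (error-mono (x≤x+y f (0≤* (0≤fromℕ q) (0≤½^ j))) eF)

  module _ (k : ℕ) where

    levelError : ℕ → ℝ
    levelError zero    = 0#
    levelError (suc ℓ) = levelError ℓ + ½ ^ (k ℕ.+ suc ℓ)

    levelError≤ : ∀ ℓ → levelError ℓ ≤ ½ ^ k
    levelError≤ ℓ = ≤-trans (x≤x+y _ (0≤½^ (k ℕ.+ ℓ))) (≤-reflexive (telescope ℓ))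
      where
      telescope : ∀ ℓ → levelError ℓ + ½ ^ (k ℕ.+ ℓ) ≈ ½ ^ k
      telescope zero    rewrite ℕ.+-identityʳ k = +-identityˡ (½ ^ k)
      telescope (suc ℓ) rewrite ℕ.+-suc k ℓ     = trans (+-assoc _ _ _)
        (trans (+-congˡ (½^-double (k ℕ.+ ℓ))) (telescope ℓ))

    error-level : ∀ ℓ {q} → q ℕ.≤ width ℓ →
      levelError ℓ + fromℕ q * ½ ^ strength k ℓ ≤ levelError (suc ℓ)
    error-level ℓ {q} q≤w = +-monoʳ-≤ (levelError ℓ) (begin
      fromℕ q * ½ ^ strength k ℓ
        ≤⟨ *-monoˡ-≤′ (0≤½^ (strength k ℓ)) (fromℕ-mono-≤ q≤w) ⟩
      W * ½ ^ strength k ℓ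
        ≈⟨ *-congˡ (^-homo-* ½ (k ℕ.+ suc ℓ) (2 ℕ.^ ℓ)) ⟩
      W * (H * ½ ^ (2 ℕ.^ ℓ))
        ≈⟨ S.solve 3 (λ w h x → w :* (h :* x) := h :* (w :* x)) refl W H (½ ^ (2 ℕ.^ ℓ)) ⟩
      H * (W * ½ ^ (2 ℕ.^ ℓ))
        ≈⟨ *-congˡ (2^n*½^n≈1 (2 ℕ.^ ℓ)) ⟩
      H * 1#
        ≈⟨ *-identityʳ H ⟩
      H ∎)
      where
      W = fromℕ (width ℓ)
      H = ½ ^ (k ℕ.+ suc ℓ)

    error-full : ∀ ℓ → ErrorAtMost (full k ℓ) (levelError ℓ)
    error-full zero    = leaf ≤-refl
    error-full (suc ℓ) = error-mono (error-level ℓ ℕ.≤-refl)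
      (error-chain (error-full ℓ) (error-full ℓ) (width ℓ))

    error-partial : ∀ ℓ {i} → i ℕ.< capacity ℓ → ErrorAtMost (partial k ℓ i) (levelError ℓ)
    error-partial zero        i<c = leaf ≤-refl
    error-partial (suc ℓ) {i} i<c = error-mono (error-level ℓ (quot≤width ℓ i<c))
      (error-chain (error-full ℓ) (error-partial ℓ (rem<capacity ℓ i)) (quot ℓ i))

module Success {c ℓ₁ ℓ₂} (R : Reals c ℓ₁ ℓ₂) where
  open Reals R hiding (zero)
  open RealProperties R
  open OrderedField R
  open ErrorBounds R
  open CoinTossing R
  open ≤-Reasoning
  open S using (_:*_; _:+_; _:=_)

  -- z ^ (j - i), with y = 1 / z, is an upper bound on the indicator of i ≤ j.  Its
  -- expectation is multiplied by at most ρ in every round in which b, with i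
  -- heads, and another coin, with j heads, are tossed.
  record Separates {n} (s : ℕ) (p : Biases n) (b : Fin n) : Set (c l⊔ ℓ₁ l⊔ ℓ₂) where
    field
      y z ρ  : ℝ
      0≤y    : 0# ≤ y
      1≤z    : 1# ≤ z
      yz≈1   : y * z ≈ 1#
      0≤ρ    : 0# ≤ ρ
      ρ^s≤½  : ρ ^ s ≤ ½
      factor : ∀ a → a ≢ b →
        (p b * y + (1# - p b)) * (p a * z + (1# - p a)) ≤ ρ

  module _ {n} {p : Biases n} (isBiases : IsBiases p) (b : Fin n) where

    private
      variable
        t : ℕ
        M : Subset n

      Pr : Program n t M → ℝ
      Pr P = Pr[ P outputs b ∣ p ]

      0≤p : ∀ i → 0# ≤ p i
      0≤p i = proj₁ (isBiases i)

      0≤1-p : ∀ i → 0# ≤ 1# - p i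
      0≤1-p i = x≤y⇒0≤y-x (proj₂ (isBiases i))

      p+1-p≈1 : ∀ i → p i + (1# - p i) ≈ 1#
      p+1-p≈1 i = x+[y-x]≈y (p i) 1#

    Pr-skip : ∀ d {le : d ℕ.+ t ℕ.≤ n} {P : Program n (d ℕ.+ t) M} → Pr (skip d le P) ≡ Pr P
    Pr-skip zero    = ≡.refl
    Pr-skip (suc d) = Pr-skip d

    0≤Pr : (P : Program n t M) → 0# ≤ Pr P
    0≤Pr (next _ P)     = 0≤Pr P
    0≤Pr (toss c _ P)   =
      0≤+ (0≤* (0≤p c) (0≤Pr (P true))) (0≤* (0≤1-p c) (0≤Pr (P false)))
    0≤Pr (random k P)   = 0≤* (<⇒≤ (0<1/suc k)) (0≤sum (λ i → 0≤Pr (P i)))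
    0≤Pr (store _ _ P)  = 0≤Pr P
    0≤Pr (discard _ P)  = 0≤Pr P
    0≤Pr (output _ c _) with c ≟ b
    ... | yes _ = 0≤1
    ... | no  _ = ≤-refl

    -- With the error on the right-hand side there is no subtraction, and the errors of the two
    -- branches of a toss are simply averaged.
    Succeeds : ℝ → ℝ → Program n t M → Set ℓ₂
    Succeeds v e P = v ≤ Pr P + e

    succeeds-mono : ∀ {v e e′} {P : Program n t M} → e ≤ e′ → Succeeds v e P → Succeeds v e′ P
    succeeds-mono {P = P} e≤e′ le = ≤-trans le (+-monoʳ-≤ (Pr P) e≤e′)

    succeeds-toss : ∀ {c} {a : Available t M c} {P v e e₁ e₀} →
      Succeeds v e₁ (P true) → Succeeds v e₀ (P false) →
      p c * e₁ + (1# - p c) * e₀ ≤ e → Succeeds v e (toss c a P)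
    succeeds-toss {c = c} {a} {P} {v} {e} {e₁} {e₀} s₁ s₀ avg = begin
      v                                              ≈⟨ *-identityˡ v ⟨
      1# * v                                         ≈⟨ *-congʳ (p+1-p≈1 c) ⟨
      (x + x̄) * v                                    ≈⟨ distribʳ v x x̄ ⟩
      x * v + x̄ * v                                  ≤⟨ +-mono-≤
        (*-monoʳ-≤′ (0≤p c) s₁) (*-monoʳ-≤′ (0≤1-p c) s₀) ⟩
      x * (A₁ + e₁) + x̄ * (A₀ + e₀)                  ≈⟨ S.solve 6 (λ x x̄ A₁ A₀ e₁ e₀ →
        x :* (A₁ :+ e₁) :+ x̄ :* (A₀ :+ e₀) := (x :* A₁ :+ x̄ :* A₀) :+ (x :* e₁ :+ x̄ :* e₀))
        refl x x̄ A₁ A₀ e₁ e₀ ⟩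
      (x * A₁ + x̄ * A₀) + (x * e₁ + x̄ * e₀)          ≤⟨ +-monoʳ-≤ _ avg ⟩
      (x * A₁ + x̄ * A₀) + e                          ∎
      where
      x  = p c
      x̄  = 1# - p c
      A₁ = Pr (P true)
      A₀ = Pr (P false)

    succeeds-toss-any : ∀ {c} {a : Available t M c} {P v e} →
      (∀ x → Succeeds v e (P x)) → Succeeds v e (toss c a P)
    succeeds-toss-any {c = c} {a} {P} {e = e} s = succeeds-toss {a = a} {P} (s true) (s false)
      (≤-reflexive (trans (sym (distribʳ e (p c) _))
        (trans (*-congʳ (p+1-p≈1 c)) (*-identityˡ e))))

    module _ {c₁ c₂ : Fin n} {a₁ : Available t M c₁} {a₂ : Available t M c₂} where

      succeeds-compete-any : ∀ r i j {k v e} → (∀ x → Succeeds v e (k x)) →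
        Succeeds v e (compete a₁ a₂ r i j k)
      succeeds-compete-any zero    i j s = s (j <ᵇ i)
      succeeds-compete-any (suc r) i j {k} s =
        succeeds-toss-any {a = a₁} {second} λ x → succeeds-toss-any {a = a₂} {third x} λ y →
        succeeds-compete-any r (count x i) (count y j) {k} s
        where
        third : Bool → Bool → Program n t M
        third x y = compete a₁ a₂ r (count x i) (count y j) k
        second : Bool → Program n t M
        second x = toss c₂ a₂ (third x)

      module _ {α β ρ v e : ℝ} (0≤α : 0# ≤ α) (0≤β : 0# ≤ β) (0≤ρ : 0# ≤ ρ)
        (factor : (p c₁ * α + (1# - p c₁)) * (p c₂ * β + (1# - p c₂)) ≤ ρ)
        {k : Bool → Program n t M}
        (final : ∀ i j → Succeeds v (e + α ^ i * β ^ j) (k (j <ᵇ i))) where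

        private
          x  = p c₁
          x̄  = 1# - p c₁
          w  = p c₂
          w̄  = 1# - p c₂

        -- The pair `α`, `β` is `y`, `z` or `z`, `y`, depending on which contestant is the best
        -- coin. The term `ρ ^ r * (α ^ i * β ^ j)` is a potential that does not increase in
        -- expectation from one round to the next, so induction on `r` reduces the claim to the
        -- final scores.
        succeeds-compete : ∀ r i j →
          Succeeds v (e + ρ ^ r * (α ^ i * β ^ j)) (compete a₁ a₂ r i j k)
        succeeds-compete zero    i j =
          succeeds-mono {P = k (j <ᵇ i)} (≤-reflexive (+-congˡ (sym (*-identityˡ _)))) (final i j)
        succeeds-compete (suc r) i j =
          succeeds-toss {a = a₁} {λ x → toss c₂ a₂ (third x)} (second true) (second false) (begin
            x * (e + P * (α * A * (F₂ * B))) + x̄ * (e + P * (A * (F₂ * B)))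
              ≈⟨ S.solve 8 (λ x x̄ e P α A F₂ B →
                x :* (e :+ P :* (α :* A :* (F₂ :* B))) :+ x̄ :* (e :+ P :* (A :* (F₂ :* B))) :=
                (x :+ x̄) :* e :+ P :* (A :* B) :* ((x :* α :+ x̄) :* F₂)) refl x x̄ e P α A F₂ B ⟩
            (x + x̄) * e + P * (A * B) * ((x * α + x̄) * F₂)
              ≤⟨ +-mono-≤ (≤-reflexive (trans (*-congʳ (p+1-p≈1 c₁)) (*-identityˡ e)))
                   (*-monoʳ-≤′ (0≤* (0≤^ 0≤ρ r) (0≤* (0≤^ 0≤α i) (0≤^ 0≤β j))) factor) ⟩
            e + P * (A * B) * ρ
              ≈⟨ S.solve 4 (λ e P X ρ → e :+ P :* X :* ρ := e :+ ρ :* P :* X) refl e P (A * B) ρ ⟩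
            e + ρ * P * (A * B) ∎)
          where
          P  = ρ ^ r
          A  = α ^ i
          B  = β ^ j
          F₂ = w * β + w̄
          third : Bool → Bool → Program n t M
          third x y = compete a₁ a₂ r (count x i) (count y j) k
          second : ∀ x → Succeeds v (e + P * (α ^ count x i * (F₂ * B))) (toss c₂ a₂ (third x))
          second x = succeeds-toss {a = a₂} {third x}
            (succeeds-compete r (count x i) (suc j)) (succeeds-compete r (count x i) j)
            (≤-reflexive (trans
              (S.solve 7 (λ w w̄ e P A β B →
                w :* (e :+ P :* (A :* (β :* B))) :+ w̄ :* (e :+ P :* (A :* B)) :=
                (w :+ w̄) :* e :+ P :* (A :* ((w :* β :+ w̄) :* B)))
                refl w w̄ e P (α ^ count x i) β B)
              (+-congʳ (trans (*-congʳ (p+1-p≈1 c₂)) (*-identityˡ e)))))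

    module _ {s : ℕ} (sep : Separates s p b) where
      open Separates sep

      private
        0≤z : 0# ≤ z
        0≤z = ≤-trans 0≤1 1≤z

        1≤y^i*z^j : ∀ {i j} → i ℕ.≤ j → 1# ≤ y ^ i * z ^ j
        1≤y^i*z^j {i} {j} i≤j = begin
          1#                              ≤⟨ 1≤^ 1≤z (j ℕ.∸ i) ⟩
          Z                               ≈⟨ *-identityˡ Z ⟨
          1# * Z                          ≈⟨ *-congʳ (trans (^-congˡ i yz≈1) (1^n≈1 i)) ⟨
          (y * z) ^ i * Z                 ≈⟨ *-congʳ (^-distrib-* y z i) ⟩
          y ^ i * z ^ i * Z               ≈⟨ *-assoc _ _ _ ⟩
          y ^ i * (z ^ i * Z)             ≈⟨ *-congˡ (^-homo-* z i (j ℕ.∸ i)) ⟨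
          y ^ i * z ^ (i ℕ.+ (j ℕ.∸ i))   ≡⟨ ≡.cong (λ m → y ^ i * z ^ m) (ℕ.m+[n∸m]≡n i≤j) ⟩
          y ^ i * z ^ j                   ∎
          where Z = z ^ (j ℕ.∸ i)

        ρ^≤½^ : ∀ j → ρ ^ (s ℕ.* j) ≤ ½ ^ j
        ρ^≤½^ j = ≤-resp (^-assocʳ ρ s j) refl (^-mono-≤ (0≤^ 0≤ρ s) ρ^s≤½ j)

        initial : ∀ j e → e + ρ ^ (s ℕ.* j) * (1# * 1#) ≤ e + ½ ^ j
        initial j e = +-monoʳ-≤ e
          (≤-resp (sym (trans (*-congˡ (*-identityˡ 1#)) (*-identityʳ _))) refl (ρ^≤½^ j))

        -- For scores with which the best coin may lose, the moment bound is at least 1. The claim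
        -- is then void, whatever the continuation does.
        lost : ∀ {P : Program n t M} {v e f} → v ≤ 1# → 0# ≤ e → 1# ≤ f → Succeeds v (e + f) P
        lost {P = P} v≤1 0≤e 1≤f =
          ≤-trans v≤1 (≤-trans 1≤f (≤-trans (x≤y+x _ 0≤e) (x≤y+x _ (0≤Pr P))))

      module _ {c₁ c₂ : Fin n} {a₁ : Available t M c₁} {a₂ : Available t M c₂} {v e : ℝ}
        (v≤1 : v ≤ 1#) (0≤e : 0# ≤ e) (j : ℕ) {k : Bool → Program n t M} where

        best-wins-first : c₁ ≡ b → c₂ ≢ b → Succeeds v e (k true) →
          Succeeds v (e + ½ ^ j) (compete a₁ a₂ (s ℕ.* j) 0 0 k)
        best-wins-first ≡.refl c₂≢b won =
          succeeds-mono {P = compete a₁ a₂ (s ℕ.* j) 0 0 k} (initial j e)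
            (succeeds-compete 0≤y 0≤z 0≤ρ (factor _ c₂≢b) final (s ℕ.* j) 0 0)
          where
          final : ∀ i j → Succeeds v (e + y ^ i * z ^ j) (k (j <ᵇ i))
          final i j with j <ᵇ i | ℕ.<ᵇ-reflects-< j i
          ... | true  | _        =
            succeeds-mono {P = k true} (x≤x+y e (0≤* (0≤^ 0≤y i) (0≤^ 0≤z j))) won
          -- Ties go to `c₂` and fall under this case; the bound is on the indicator of `i ≤ j` and
          -- so includes them.
          ... | false | ofⁿ j≮i = lost {P = k false} v≤1 0≤e (1≤y^i*z^j (ℕ.≮⇒≥ j≮i))

        best-wins-second : c₂ ≡ b → c₁ ≢ b → Succeeds v e (k false) →
          Succeeds v (e + ½ ^ j) (compete a₁ a₂ (s ℕ.* j) 0 0 k)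
        best-wins-second ≡.refl c₁≢b won =
          succeeds-mono {P = compete a₁ a₂ (s ℕ.* j) 0 0 k} (initial j e)
            (succeeds-compete 0≤z 0≤y 0≤ρ
              (≤-resp (*-comm _ _) refl (factor _ c₁≢b)) final (s ℕ.* j) 0 0)
          where
          final : ∀ i j → Succeeds v (e + z ^ i * y ^ j) (k (j <ᵇ i))
          final i j with j <ᵇ i | ℕ.<ᵇ-reflects-< j i
          ... | true  | ofʸ j<i = lost {P = k true} v≤1 0≤e
            (≤-resp refl (*-comm _ _) (1≤y^i*z^j (ℕ.<⇒≤ j<i)))
          ... | false | _        =
            succeeds-mono {P = k false} (x≤x+y e (0≤* (0≤^ 0≤z i) (0≤^ 0≤y j))) won

      -- For groups without the best coin: it does not matter who wins them, so they add no error.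
      succeeds-play-any : ∀ T {a : Arrived t M} {u≤n} {k : Continuation t M (finish T t)} {v e} →
        (∀ c {M′} (w : Won M t _ c M′) → Succeeds v e (k c w)) →
        Succeeds v e (play s T a u≤n k)
      succeeds-play-any leaf         ok = ok _ _
      succeeds-play-any (duel j T U) ok =
        succeeds-play-any T λ c₁ w₁ → succeeds-play-any U λ c₂ w₂ →
        succeeds-compete-any (s ℕ.* j) 0 0 λ where
          true  → ok _ _
          false → ok _ _

      -- The continuation of the half with the best coin contains the later duel. The error `½ ^ j`
      -- of that duel is therefore added to the error `e` of the continuation, and the half itself
      -- keeps `f′`.
      succeeds-play : ∀ {T f} → ErrorAtMost T f → ∀ {a : Arrived t M} {u≤n}
        {k : Continuation t M (finish T t)} {v e} → v ≤ 1# → 0# ≤ e →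
        t ℕ.≤ toℕ b → toℕ b ℕ.< finish T t →
        (∀ {c M′} (w : Won M t _ c M′) → c ≡ b → Succeeds v e (k c w)) →
        Succeeds v (e + f) (play s T a u≤n k)
      succeeds-play (leaf 0≤f) {a} {u≤n} {k} {e = e} v≤1 0≤e t≤b b<u ok =
        succeeds-mono {P = k _ (won-leaf u≤n a)} (x≤x+y e 0≤f)
          (ok _ (toℕ-injective (≡.trans (toℕ-fromℕ< u≤n) (ℕ.≤-antisym t≤b (ℕ.s≤s⁻¹ b<u)))))
      succeeds-play {t = t} {T = duel j T U} {f} (duel f′ f′+≤f eT eU) {a} {u≤n} {k} {v} {e}
        v≤1 0≤e t≤b b<u ok =
        succeeds-mono {P = play s (duel j T U) a u≤n k} total
          (by-halves (ℕ.<-≤-connex (toℕ b) (finish T t)))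
        where
        total : e + ½ ^ j + f′ ≤ e + f
        total = ≤-resp (S.solve 3 (λ e h f → e :+ (f :+ h) := e :+ h :+ f) refl e (½ ^ j) f′)
          refl (+-monoʳ-≤ e f′+≤f)
        0≤e+ : 0# ≤ e + ½ ^ j
        0≤e+ = 0≤+ 0≤e (0≤½^ j)
        by-halves : (toℕ b ℕ.< finish T t) ⊎ (finish T t ℕ.≤ toℕ b) →
          Succeeds v (e + ½ ^ j + f′) (play s (duel j T U) a u≤n k)
        by-halves (inj₁ b<v) = succeeds-play eT v≤1 0≤e+ t≤b b<v λ w₁ c₁≡b →
          succeeds-play-any U λ c₂ w₂ →
          best-wins-first v≤1 0≤e j c₁≡b
            (λ c₂≡b → c₁≢c₂ a w₁ w₂ (≡.trans c₁≡b (≡.sym c₂≡b)))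
            (ok (won-first a w₁ w₂) c₁≡b)
        by-halves (inj₂ v≤b) = succeeds-play-any T λ c₁ w₁ →
          succeeds-play eU v≤1 0≤e+ v≤b b<u λ w₂ c₂≡b →
          best-wins-second v≤1 0≤e j c₂≡b
            (λ c₁≡b → c₁≢c₂ a w₁ w₂ (≡.trans c₁≡b (≡.sym c₂≡b)))
            (ok (won-second a w₁ w₂) c₂≡b)

      succeeds-tournament : ∀ {start T f} {u≤n} → ErrorAtMost T f →
        start ℕ.+ 0 ℕ.≤ toℕ b → toℕ b ℕ.< finish T (start ℕ.+ 0) →
        Succeeds 1# f (tournamentAlgorithm s start T u≤n)
      succeeds-tournament {start} {T} {f} {u≤n} eT s≤b b<u = begin
        1#            ≤⟨ succeeds-play eT ≤-refl ≤-refl s≤b b<u announced ⟩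
        _ + (0# + f)  ≈⟨ +-congˡ (+-identityˡ f) ⟩
        _ + f         ≡⟨ ≡.cong (_+ f) (Pr-skip start) ⟨
        Pr (tournamentAlgorithm s start T u≤n) + f ∎
        where
        announced : ∀ {c M′} (w : Won _ _ _ c M′) → c ≡ b →
          Succeeds 1# 0# (announce s start T u≤n c w)
        announced {c} w c≡b = ≤-reflexive (sym (trans (+-identityʳ _)
          (trans (reflexive (Pr-skip (n ℕ.∸ finish T (start ℕ.+ 0))))
            (hit {e = ℕ.m∸n+n≡m u≤n} {a = inj₂ (Won.c∈M′ w)}))))
          where
          hit : ∀ {t M} {e : t ≡ n} {a : Available t M c} → Pr (output e c a) ≈ 1#
          hit with c ≟ b
          ... | yes _   = refl
          ... | no c≢b = contradiction c≡b c≢b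

    -- Only the branch `i` is counted; all others may fail.
    succeeds-random : ∀ k {P : Fin (suc k) → Program n t M} {v e} i → Succeeds v e (P i) →
      v ≤ fromℕ (suc k) * Pr (random k P) + e
    succeeds-random k {P} {v} {e} i ok = begin
      v                                            ≤⟨ ok ⟩
      Pr (P i) + e                                 ≤⟨ +-monoˡ-≤ e (term≤sum (λ i → 0≤Pr (P i)) i) ⟩
      Σ + e                                        ≈⟨ +-congʳ (*-identityˡ Σ) ⟨
      1# * Σ + e                                   ≈⟨ +-congʳ (*-congʳ
                                                        (*-inverseʳ _ (0<fromℕ-suc k))) ⟨
      fromℕ (suc k) * 1/suc k * Σ + e              ≈⟨ +-congʳ (*-assoc _ _ Σ) ⟩
      fromℕ (suc k) * (1/suc k * Σ) + e            ∎
      where Σ = sum (λ i → Pr (P i))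

-- The number of rounds of a duel

module Separation {c ℓ₁ ℓ₂} (R : Reals c ℓ₁ ℓ₂) where
  open Reals R hiding (zero)
  open RealProperties R
  open OrderedField R
  open CoinTossing R
  open Success R
  open ≤-Reasoning
  open S using (_:*_; _:+_; _:=_; con)

  -- The field `factor` cleared of denominators, where `a` is 1 minus the largest bias, `q` another
  -- bias and `z = 1 + t`. The product `m` of the last two factors is at most `1 + (a + q) t + t²`,
  -- hence at most `1 + t - t²` and in particular at most 2. The factor `1 + x` thus adds at most
  -- `2 x = t²`.
  factor-bound : ∀ {a q t x} → 0# ≤ a → 0# ≤ q → 0# ≤ t → 0# ≤ x →
    t * t ≈ x + x → a + q + (t + t) ≤ 1# →
    (1# + x) * ((1# + a * t) * (1# + q * t)) ≤ 1# + t
  factor-bound {a} {q} {t} {x} 0≤a 0≤q 0≤t 0≤x tt≈2x sum≤1 = begin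
    (1# + x) * m                ≈⟨ distribʳ m 1# x ⟩
    1# * m + x * m              ≤⟨ +-mono-≤ (≤-reflexive (*-identityˡ m)) (*-monoʳ-≤′ 0≤x m≤2) ⟩
    m + x * (1# + 1#)           ≈⟨ +-congˡ (trans (distribˡ x 1# 1#)
                                        (+-cong (*-identityʳ x) (*-identityʳ x))) ⟩
    m + (x + x)                 ≈⟨ +-congˡ tt≈2x ⟨
    m + t * t                   ≤⟨ m+tt≤1+t ⟩
    1# + t                      ∎
    where
    m = (1# + a * t) * (1# + q * t)
    0≤tt = 0≤* 0≤t 0≤t
    a≤1 : a ≤ 1#
    a≤1 = ≤-trans (≤-trans (x≤x+y a 0≤q) (x≤x+y (a + q) (0≤+ 0≤t 0≤t))) sum≤1
    q≤1 : q ≤ 1#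
    q≤1 = ≤-trans (≤-trans (x≤y+x q 0≤a) (x≤x+y (a + q) (0≤+ 0≤t 0≤t))) sum≤1
    t≤1 : t ≤ 1#
    t≤1 = ≤-trans (≤-trans (x≤x+y t 0≤t) (x≤y+x (t + t) (0≤+ 0≤a 0≤q))) sum≤1
    m+tt≤1+t : m + t * t ≤ 1# + t
    m+tt≤1+t = begin
      m + t * t
        ≈⟨ S.solve 3 (λ a q t → (con 1 :+ a :* t) :* (con 1 :+ q :* t) :+ t :* t :=
             con 1 :+ (a :+ q) :* t :+ t :* t :+ a :* q :* (t :* t)) refl a q t ⟩
      1# + (a + q) * t + t * t + a * q * (t * t)
        ≤⟨ +-monoʳ-≤ _ (*-monoˡ-≤′ 0≤tt (*-mono-≤ 0≤q 0≤1 a≤1 q≤1)) ⟩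
      1# + (a + q) * t + t * t + 1# * 1# * (t * t)
        ≈⟨ S.solve 3 (λ a q t → con 1 :+ (a :+ q) :* t :+ t :* t :+ con 1 :* con 1 :* (t :* t) :=
             con 1 :+ (a :+ q :+ (t :+ t)) :* t) refl a q t ⟩
      1# + (a + q + (t + t)) * t
        ≤⟨ +-monoʳ-≤ 1# (*-monoˡ-≤′ 0≤t sum≤1) ⟩
      1# + 1# * t
        ≈⟨ +-congˡ (*-identityˡ t) ⟩
      1# + t ∎
    m≤2 : m ≤ 1# + 1#
    m≤2 = ≤-trans (x≤x+y m 0≤tt) (≤-trans m+tt≤1+t (+-monoʳ-≤ 1# t≤1))

  module _ {Δ : ℝ} (0<Δ : 0# < Δ) where

    private
      t x : ℝ
      -- The gap is `2 t`, and `t² = 2 x` is what `factor-bound` requires; so `1 / x = 8 / Δ²`.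
      t = Δ * ½
      x = t * t * ½

      0<t : 0# < t
      0<t = *-pos 0<Δ 0<½

      0<x : 0# < x
      0<x = *-pos (*-pos 0<t 0<t) 0<½

      0≤t = <⇒≤ 0<t
      0≤x = <⇒≤ 0<x

      0<1+ : ∀ {w} → 0# < w → 0# < 1# + w
      0<1+ 0<w = <-trans 0<1 (x<x+y 0<w)

    -- Bernoulli's inequality then gives `2 ≤ (1 + x) ^ s`, that is, `s` rounds halve the potential.
    HasEnoughRounds : ℕ → Set ℓ₂
    HasEnoughRounds s = 1# ≤ fromℕ s * x

    gap≤1 : ∀ {n} {p : Biases n} → IsBiases p → HasGap p Δ → Δ ≤ 1#
    gap≤1 {p = p} isBiases g = begin
      Δ                  ≤⟨ x≤y+x Δ (proj₁ (isBiases second)) ⟩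
      p second + Δ       ≈⟨ +-congˡ gap ⟨
      p second + (p best - p second) ≈⟨ x+[y-x]≈y _ _ ⟩
      p best             ≤⟨ proj₂ (isBiases best) ⟩
      1#                 ∎
      where open HasGap g

    -- If `1 < Δ`, no biases have this gap and no rounds are played. If `Δ < 2`, then `s = N + 1`
    -- with `N x < 2` and `x ≤ 1`, so `s Δ² = 8 (x + N x) ≤ 8 * 3`.
    enough-rounds : ∃[ s ] (fromℕ s * (Δ * Δ) ≤ fromℕ 24 × (Δ ≤ 1# → HasEnoughRounds s))
    enough-rounds with <-cotrans {1#} {fromℕ 2} (<-respˡ-≈ (+-identityʳ 1#) (fromℕ-suc-< 1)) Δ
    ... | inj₁ 1<Δ = 0 , ≤-resp (sym (zeroˡ _)) refl (0≤fromℕ 24) , λ Δ≤1 → contradiction 1<Δ Δ≤1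
    ... | inj₂ Δ<2 with multiple-between 0<x (0<fromℕ-suc 1)
                            (<-respˡ-≈ (+-identityʳ 1#) (fromℕ-suc-< 1))
    ...   | N , Nx<2 , 1<Nx+x = suc N , bound , λ _ → <⇒≤ 1<Nx+x
      where
      t≤1 : t ≤ 1#
      t≤1 = ≤-resp refl 2*½≈1 (*-monoˡ-≤′ (<⇒≤ 0<½) (<⇒≤ Δ<2))
      x≤1 : x ≤ 1#
      x≤1 = begin
        t * t * ½     ≤⟨ *-mono-≤ (<⇒≤ 0<½) (0≤* 0≤1 0≤1) (*-mono-≤ 0≤t 0≤1 t≤1 t≤1) ½≤1 ⟩
        1# * 1# * 1#  ≈⟨ trans (*-identityʳ _) (*-identityʳ 1#) ⟩
        1#            ∎
      bound : fromℕ (suc N) * (Δ * Δ) ≤ fromℕ 24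
      bound = begin
        fromℕ (suc N) * (Δ * Δ)
          ≈⟨ *-congˡ (*-cong (sym (x*½+x*½≈x Δ)) (sym (x*½+x*½≈x Δ))) ⟩
        fromℕ (suc N) * ((t + t) * (t + t))
          ≈⟨ S.solve 2 (λ N t → (con 1 :+ N) :* ((t :+ t) :* (t :+ t)) :=
               (con 1 :+ N) :* (num 4 :* (t :* t))) refl (fromℕ N) t ⟩
        fromℕ (suc N) * (fromℕ 4 * (t * t))
          ≈⟨ *-congˡ (*-congˡ (sym (x*½+x*½≈x (t * t)))) ⟩
        fromℕ (suc N) * (fromℕ 4 * (x + x))
          ≈⟨ S.solve 2 (λ N x → (con 1 :+ N) :* (num 4 :* (x :+ x)) :=
               num 8 :* (x :+ N :* x)) refl (fromℕ N) x ⟩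
        fromℕ 8 * (x + fromℕ N * x)
          ≤⟨ *-monoʳ-≤′ (0≤fromℕ 8) (+-mono-≤ x≤1 (<⇒≤ Nx<2)) ⟩
        fromℕ 8 * fromℕ 3
          ≈⟨ fromℕ-* 8 3 ⟨
        fromℕ 24 ∎

    separates : ∀ {n s} {p : Biases n} → IsBiases p → (g : HasGap p Δ) →
      HasEnoughRounds s → Separates s p (HasGap.best g)
    separates {n} {s} {p} isBiases g 1≤sx = record
      { y      = y
      ; z      = z
      ; ρ      = ρ
      ; 0≤y    = <⇒≤ (inv-pos z 0<z)
      ; 1≤z    = x≤x+y 1# 0≤t
      ; yz≈1   = trans (*-comm y z) (*-inverseʳ z 0<z)
      ; 0≤ρ    = 0≤ρ
      ; ρ^s≤½  = ρ^s≤½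
      ; factor = factor
      }
      where
      open HasGap g
      z = 1# + t
      0<z = 0<1+ 0<t
      y = inv z 0<z
      0<1+x = 0<1+ 0<x
      ρ = inv (1# + x) 0<1+x
      0≤ρ = <⇒≤ (inv-pos _ 0<1+x)

      ρ^s≤½ : ρ ^ s ≤ ½
      ρ^s≤½ = *-cancelˡ-≤ (0<fromℕ-suc 1) (begin
        fromℕ 2 * ρ ^ s              ≤⟨ *-monoˡ-≤′ (0≤^ 0≤ρ s) 2≤ ⟩
        (1# + x) ^ s * ρ ^ s         ≈⟨ ^-distrib-* (1# + x) ρ s ⟨
        ((1# + x) * ρ) ^ s           ≈⟨ ^-congˡ s (*-inverseʳ _ 0<1+x) ⟩
        1# ^ s                       ≈⟨ 1^n≈1 s ⟩
        1#                           ≈⟨ 2*½≈1 ⟨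
        fromℕ 2 * ½                  ∎)
        where
        2≤ : fromℕ 2 ≤ (1# + x) ^ s
        2≤ = ≤-trans (+-monoʳ-≤ 1# (≤-resp (sym (+-identityʳ 1#)) refl 1≤sx)) (bernoulli 0≤x s)

      factor : ∀ a → a ≢ best → (p best * y + (1# - p best)) * (p a * z + (1# - p a)) ≤ ρ
      factor a a≢best = *-cancelˡ-≤ 0<1+x (*-cancelˡ-≤ 0<z (begin
        z * ((1# + x) * ((P * y + P̄) * (q * z + q̄)))
          ≈⟨ S.solve 7 (λ z w P P̄ q q̄ y →
               z :* (w :* ((P :* y :+ P̄) :* (q :* z :+ q̄))) :=
               w :* ((P :* (z :* y) :+ P̄ :* z) :* (q :* z :+ q̄))) refl z (1# + x) P P̄ q q̄ y ⟩
        (1# + x) * ((P * (z * y) + P̄ * z) * (q * z + q̄))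
          ≈⟨ *-congˡ (*-congʳ (+-congʳ (*-congˡ (*-inverseʳ z 0<z)))) ⟩
        (1# + x) * ((P * 1# + P̄ * z) * (q * z + q̄))
          ≈⟨ S.solve 6 (λ t w P P̄ q q̄ →
               w :* ((P :* con 1 :+ P̄ :* (con 1 :+ t)) :* (q :* (con 1 :+ t) :+ q̄)) :=
               w :* (((P :+ P̄) :+ P̄ :* t) :* ((q :+ q̄) :+ q :* t))) refl t (1# + x) P P̄ q q̄ ⟩
        (1# + x) * (((P + P̄) + P̄ * t) * ((q + q̄) + q * t))
          ≈⟨ *-congˡ (*-cong (+-congʳ (x+[y-x]≈y P 1#)) (+-congʳ (x+[y-x]≈y q 1#))) ⟩
        (1# + x) * ((1# + P̄ * t) * (1# + q * t))
          ≤⟨ factor-bound (x≤y⇒0≤y-x (proj₂ (isBiases best))) (proj₁ (isBiases a)) 0≤t 0≤x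
               (sym (x*½+x*½≈x (t * t))) separated ⟩
        z
          ≈⟨ trans (*-congˡ (*-inverseʳ _ 0<1+x)) (*-identityʳ z) ⟨
        z * ((1# + x) * ρ) ∎))
        where
        P = p best
        P̄ = 1# - P
        q = p a
        q̄ = 1# - q
        separated : P̄ + q + (t + t) ≤ 1#
        separated = begin
          P̄ + q + (t + t)                    ≈⟨ +-assoc P̄ q _ ⟩
          P̄ + (q + (t + t))                  ≤⟨ +-monoʳ-≤ P̄ (+-mono-≤ (second-max a a≢best)
                                                   (≤-reflexive (trans (x*½+x*½≈x Δ) (sym gap)))) ⟩
          P̄ + (p second + (P - p second))    ≈⟨ +-congˡ (x+[y-x]≈y (p second) P) ⟩
          P̄ + P                              ≈⟨ trans (+-comm P̄ P) (x+[y-x]≈y P 1#) ⟩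
          1#                                 ∎

-- Lower bounds on log (1 / δ)

module LogBounds {c ℓ₁ ℓ₂} (R : Reals c ℓ₁ ℓ₂) where
  open Reals R hiding (zero)
  open RealProperties R
  open OrderedField R
  open Logarithm R
  open Separation R
  open ≤-Reasoning
  open S using (_:*_; _:+_; _:=_; con)

  module _ {δ : ℝ} (0<δ : 0# < δ) (δ<1 : δ < 1#) where

    private
      x : ℝ
      x = 1# - δ

      0≤x : 0# ≤ x
      0≤x = <⇒≤ (x<y⇒0<y-x δ<1)

      x+δ≈1 : x + δ ≈ 1#
      x+δ≈1 = trans (+-comm x δ) (x+[y-x]≈y δ 1#)

      x≤1 : x ≤ 1#
      x≤1 = ≤-resp refl x+δ≈1 (x≤x+y x (<⇒≤ 0<δ))

    mercator-mono : ∀ d m → mercator x m ≤ mercator x (d ℕ.+ m)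
    mercator-mono zero    m = ≤-refl
    mercator-mono (suc d) m = ≤-trans (mercator-mono d m)
      (x≤x+y _ (0≤* (0≤^ 0≤x (suc (d ℕ.+ m))) (<⇒≤ (0<1/suc (d ℕ.+ m)))))

    mercator-converges : ConvergesTo (mercator x) (log1/ 0<δ δ<1)
    mercator-converges = proj₂ (complete _ _)

    -- A partial sum above the limit would keep all later ones at least as far above it.
    mercator≤log1/ : ∀ m → mercator x m ≤ log1/ 0<δ δ<1
    mercator≤log1/ m l<Lm with mercator-converges _ (x<y⇒0<y-x l<Lm)
    ... | N , close = mercator-mono N m
      (<-respʳ-≈ (x+[y-x]≈y _ _) (proj₁ (close (N ℕ.+ m) (ℕ.m≤m+n N m))))

    1-δ≤log1/ : 1# - δ ≤ log1/ 0<δ δ<1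
    1-δ≤log1/ = ≤-trans (≤-reflexive (begin-equality
      x                        ≈⟨ *-identityʳ x ⟨
      x * 1#                   ≈⟨ *-congˡ (*-inverseʳ _ (0<fromℕ-suc 0)) ⟨
      x * (fromℕ 1 * 1/suc 0)  ≈⟨ S.solve 2 (λ x i → x :* ((con 1 :+ con 0) :* i) :=
                                    con 0 :+ x :* con 1 :* i) refl x (1/suc 0) ⟩
      mercator x 1             ∎)) (mercator≤log1/ 1)

    -- Bernoulli's inequality for `1 - δ`, without subtraction.
    power-bound : ∀ m → 1# ≤ x ^ m + fromℕ m * δ
    power-bound zero    = ≤-reflexive (sym (trans (+-congˡ (zeroˡ δ)) (+-identityʳ 1#)))
    power-bound (suc m) = begin
      1#                                   ≈⟨ x+δ≈1 ⟨
      x + δ                                ≈⟨ +-congʳ (*-identityʳ x) ⟨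
      x * 1# + δ                           ≤⟨ +-monoˡ-≤ δ (*-monoʳ-≤′ 0≤x (power-bound m)) ⟩
      x * (x ^ m + M * δ) + δ              ≈⟨ S.solve 4 (λ x X M δ →
        x :* (X :+ M :* δ) :+ δ := x :* X :+ (x :* (M :* δ) :+ δ)) refl x (x ^ m) M δ ⟩
      x * x ^ m + (x * (M * δ) + δ)        ≤⟨ +-monoʳ-≤ _ (+-monoˡ-≤ δ
        (*-monoˡ-≤′ (0≤* (0≤fromℕ m) (<⇒≤ 0<δ)) x≤1)) ⟩
      x * x ^ m + (1# * (M * δ) + δ)       ≈⟨ S.solve 4 (λ x X M δ →
        x :* X :+ (con 1 :* (M :* δ) :+ δ) := x :* X :+ (con 1 :+ M) :* δ) refl x (x ^ m) M δ ⟩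
      x ^ suc m + fromℕ (suc m) * δ        ∎
      where M = fromℕ m

    term-bound : ∀ {k e} → suc k ℕ.≤ 2 ℕ.^ e → fromℕ (suc k) * δ ≤ ½ →
      ½ * ½ ^ e ≤ x ^ suc k * 1/suc k
    term-bound {k} {e} k<2^e kδ≤½ = *-mono-≤ (0≤½^ e) (0≤^ 0≤x (suc k)) ½≤x^
      (*-cancelˡ-≤ (0<fromℕ-suc k) (begin
        fromℕ (suc k) * ½ ^ e         ≤⟨ *-monoˡ-≤′ (0≤½^ e) (fromℕ-mono-≤ k<2^e) ⟩
        fromℕ (2 ℕ.^ e) * ½ ^ e       ≈⟨ 2^n*½^n≈1 e ⟩
        1#                            ≈⟨ *-inverseʳ _ (0<fromℕ-suc k) ⟨
        fromℕ (suc k) * 1/suc k       ∎))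
      where
      ½≤x^ : ½ ≤ x ^ suc k
      ½≤x^ = +-cancelˡ-≤ ½ (begin
        ½ + ½                              ≈⟨ ½+½≈1 ⟩
        1#                                 ≤⟨ power-bound (suc k) ⟩
        x ^ suc k + fromℕ (suc k) * δ      ≤⟨ +-monoʳ-≤ _ kδ≤½ ⟩
        x ^ suc k + ½                      ≈⟨ +-comm _ ½ ⟩
        ½ + x ^ suc k                      ∎)

    mercator-step : ∀ d m {y} → (∀ k → k ℕ.< d ℕ.+ m → y ≤ x ^ suc k * 1/suc k) →
      mercator x m + fromℕ d * y ≤ mercator x (d ℕ.+ m)
    mercator-step zero    m {y} y≤ = ≤-reflexive (trans (+-congˡ (zeroˡ y)) (+-identityʳ _))
    mercator-step (suc d) m {y} y≤ = begin
      mercator x m + (1# + fromℕ d) * y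
        ≈⟨ S.solve 3 (λ L d y → L :+ (con 1 :+ d) :* y := L :+ d :* y :+ y) refl _ _ y ⟩
      mercator x m + fromℕ d * y + y
        ≤⟨ +-mono-≤ (mercator-step d m λ k k< → y≤ k (ℕ.m<n⇒m<1+n k<)) (y≤ (d ℕ.+ m) ℕ.≤-refl) ⟩
      mercator x (suc d ℕ.+ m) ∎

    -- Oresme's grouping of the harmonic series. While the index times `δ` is at most `½`, the
    -- powers of `x` are at least `½`, so every dyadic block of terms contributes at least `½ * ½`.
    mercator-2^ : ∀ i → fromℕ (2 ℕ.^ i) * δ ≤ ½ →
      fromℕ (suc i) * (½ * ½) ≤ mercator x (2 ℕ.^ i)
    mercator-2^ zero    δ≤½ = ≤-trans
      (≤-reflexive (sym (trans (+-identityˡ _) (*-congˡ (*-congˡ (*-identityʳ ½))))))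
      (mercator-step 1 0 {½ * ½ ^ 1} λ where
        zero _ → term-bound {0} {1} (ℕ.s≤s ℕ.z≤n) δ≤½
        (suc k) (ℕ.s≤s ()))
    mercator-2^ (suc i) 2δ≤½ = begin
      (1# + fromℕ (suc i)) * (½ * ½)
        ≈⟨ trans (distribʳ _ 1# _) (trans (+-congʳ (*-identityˡ _)) (+-comm _ _)) ⟩
      fromℕ (suc i) * (½ * ½) + ½ * ½
        ≤⟨ +-mono-≤ (mercator-2^ i (≤-trans
             (*-monoˡ-≤′ (<⇒≤ 0<δ) (fromℕ-mono-≤ (ℕ.m≤m+n D _))) 2δ≤½)) (≤-reflexive quarter) ⟩
      mercator x D + fromℕ D * (½ * ½ ^ suc i)
        ≤⟨ mercator-step D D (λ k k<2D → term-bound {e = suc i} (k≤ k<2D) (≤-trans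
             (*-monoˡ-≤′ (<⇒≤ 0<δ) (fromℕ-mono-≤ (k≤ k<2D))) 2δ≤½)) ⟩
      mercator x (D ℕ.+ D)
        ≡⟨ ≡.cong (mercator x) 2D≡ ⟨
      mercator x (2 ℕ.^ suc i) ∎
      where
      D = 2 ℕ.^ i
      2D≡ : 2 ℕ.^ suc i ≡ D ℕ.+ D
      2D≡ = ≡.cong (D ℕ.+_) (ℕ.+-identityʳ D)
      k≤ : ∀ {k} → k ℕ.< D ℕ.+ D → suc k ℕ.≤ 2 ℕ.^ suc i
      k≤ {k} = ≡.subst (suc k ℕ.≤_) (≡.sym 2D≡)
      quarter : ½ * ½ ≈ fromℕ D * (½ * ½ ^ suc i)
      quarter = sym (trans
        (S.solve 3 (λ d h x → d :* (h :* (h :* x)) := h :* h :* (d :* x)) refl (fromℕ D) ½ (½ ^ i))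
        (trans (*-congˡ (2^n*½^n≈1 i)) (*-identityʳ _)))

    log1/-lower : ∀ i → δ ≤ ½ ^ suc i → fromℕ (suc i) * (½ * ½) ≤ log1/ 0<δ δ<1
    log1/-lower i δ≤ = ≤-trans (mercator-2^ i (begin
      fromℕ (2 ℕ.^ i) * δ             ≤⟨ *-monoʳ-≤′ (0≤fromℕ (2 ℕ.^ i)) δ≤ ⟩
      fromℕ (2 ℕ.^ i) * (½ * ½ ^ i)   ≈⟨ S.solve 3 (λ d h x → d :* (h :* x) := h :* (d :* x))
                                           refl _ ½ (½ ^ i) ⟩
      ½ * (fromℕ (2 ℕ.^ i) * ½ ^ i)   ≈⟨ trans (*-congˡ (2^n*½^n≈1 i)) (*-identityʳ ½) ⟩
      ½                               ∎)) (mercator≤log1/ (2 ℕ.^ i))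

-- The algorithm

foldr-⊔-lub : ∀ {k x} {f : Fin k → ℕ} → (∀ i → f i ℕ.≤ x) → Vector.foldr _⊔_ 0 f ℕ.≤ x
foldr-⊔-lub {zero}  f≤x = ℕ.z≤n
foldr-⊔-lub {suc k} f≤x = ℕ.⊔-lub (f≤x zero) (foldr-⊔-lub (f≤x ∘ suc))

-- A tournament with error at most 2⁻ᵏ on a random one of q + 1 blocks of the
-- stream, each of length 1 + n′ / (q + 1); the last blocks may be shorter or empty.
module RandomBlock (n′ q k s L : ℕ) (1≤k : 1 ℕ.≤ k) (n<capacity : suc n′ ℕ.< capacity L) where

  n i₀ : ℕ
  n  = suc n′
  i₀ = n′ ℕ./ suc q

  record Block : Set where
    field
      offset i : ℕ
      i≤i₀    : i ℕ.≤ i₀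
      end≤n   : suc i ℕ.+ offset ℕ.≤ n

  -- An empty block is replaced by the first coin.
  block-at : ∀ offset → (offset ℕ.≤ n′) ⊎ (n′ ℕ.< offset) → Block
  block-at offset (inj₁ offset≤n′) = record
    { offset = offset
    ; i     = i₀ ⊓ (n′ ℕ.∸ offset)
    ; i≤i₀  = ℕ.m⊓n≤m i₀ _
    ; end≤n = ℕ.s≤s (ℕ.≤-trans (ℕ.+-monoˡ-≤ offset (ℕ.m⊓n≤n i₀ _))
                (ℕ.≤-reflexive (ℕ.m∸n+n≡m offset≤n′)))
    }
  block-at offset (inj₂ _) = record
    { offset = 0 ; i = 0 ; i≤i₀ = ℕ.z≤n ; end≤n = ℕ.s≤s ℕ.z≤n }

  block : Fin (suc q) → Block
  block J = block-at offset (ℕ.≤-<-connex offset n′)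
    where offset = toℕ J ℕ.* suc i₀

  i₀*q≤n : suc q ℕ.* i₀ ℕ.≤ n
  i₀*q≤n = ℕ.m≤n⇒m≤1+n (≡.subst (ℕ._≤ n′) (ℕ.*-comm i₀ (suc q)) (m/n*n≤m n′ (suc q)))

  n≤blocks : n ℕ.≤ suc q ℕ.* suc i₀
  n≤blocks = begin
    suc n′                                    ≡⟨ ≡.cong suc (m≡m%n+[m/n]*n n′ (suc q)) ⟩
    suc (n′ ℕ.% suc q) ℕ.+ i₀ ℕ.* suc q       ≤⟨ ℕ.+-monoˡ-≤ _ (m%n<n n′ (suc q)) ⟩
    suc i₀ ℕ.* suc q                          ≡⟨ ℕ.*-comm (suc i₀) (suc q) ⟩
    suc q ℕ.* suc i₀                          ∎
    where open ℕ.≤-Reasoning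

  Contains : Block → ℕ → Set
  Contains B b = offset ℕ.≤ b × b ℕ.< suc i ℕ.+ offset
    where open Block B

  find-block : ∀ b → b ℕ.≤ n′ → ∃[ J ] Contains (block J) b
  find-block b b≤n′ = fromℕ< j<q , ≡.subst
    (λ j → Contains (block-at (j ℕ.* m) (ℕ.≤-<-connex (j ℕ.* m) n′)) b)
    (≡.sym (toℕ-fromℕ< j<q)) (contains (ℕ.≤-<-connex (j ℕ.* m) n′))
    where
    m = suc i₀
    j = b ℕ./ m
    j<q : j ℕ.< suc q
    j<q = m<n*o⇒m/o<n (ℕ.<-≤-trans (ℕ.s≤s b≤n′) n≤blocks)
    jm≤b : j ℕ.* m ℕ.≤ b
    jm≤b = m/n*n≤m b m
    b≤ : b ℕ.≤ i₀ ℕ.+ j ℕ.* m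
    b≤ = ≡.subst (ℕ._≤ i₀ ℕ.+ j ℕ.* m) (≡.sym (m≡m%n+[m/n]*n b m))
      (ℕ.+-monoˡ-≤ (j ℕ.* m) (ℕ.s≤s⁻¹ (m%n<n b m)))
    contains : ∀ c → Contains (block-at (j ℕ.* m) c) b
    contains (inj₁ jm≤n′) = jm≤b , ℕ.s≤s (≡.subst (b ℕ.≤_)
      (≡.sym (ℕ.+-distribʳ-⊓ (j ℕ.* m) i₀ _))
      (ℕ.⊓-glb b≤ (≡.subst (b ℕ.≤_) (≡.sym (ℕ.m∸n+n≡m jm≤n′)) b≤n′)))
    contains (inj₂ n′<jm) = contradiction (ℕ.≤-trans jm≤b b≤n′) (ℕ.<⇒≱ n′<jm)

  module _ (B : Block) where
    open Block B

    i<capacity : i ℕ.< capacity L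
    i<capacity = ℕ.<-trans (ℕ.≤-trans (ℕ.m≤m+n (suc i) offset) end≤n) n<capacity

    tournament : Tournament
    tournament = partial k L i

    finish-tournament : finish tournament (offset ℕ.+ 0) ≡ suc i ℕ.+ offset
    finish-tournament = ≡.trans (finish≡size+ tournament _)
      (≡.cong₂ ℕ._+_ (size-partial k L i<capacity) (ℕ.+-identityʳ offset))

    blockAlgorithm : Algorithm n
    blockAlgorithm = tournamentAlgorithm s offset tournament
      (≡.subst (ℕ._≤ n) (≡.sym finish-tournament) end≤n)

    tosses-block : tosses blockAlgorithm ℕ.≤ 12 ℕ.* s ℕ.* k ℕ.* i₀
    tosses-block = begin
      tosses blockAlgorithm          ≤⟨ tosses-tournament s offset tournament _ ⟩
      s ℕ.* cost tournament ℕ.* 2    ≤⟨ ℕ.*-monoˡ-≤ 2 (ℕ.*-monoʳ-≤ s (ℕ.≤-trans (cost-partial k L i)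
                                          (ℕ.*-mono-≤ (rate≤6k k 1≤k) i≤i₀))) ⟩
      s ℕ.* (6 ℕ.* k ℕ.* i₀) ℕ.* 2   ≡⟨ regroup s k i₀ ⟩
      12 ℕ.* s ℕ.* k ℕ.* i₀          ∎
      where
      open ℕ.≤-Reasoning
      regroup : ∀ s k i → s ℕ.* (6 ℕ.* k ℕ.* i) ℕ.* 2 ≡ 12 ℕ.* s ℕ.* k ℕ.* i
      regroup = solve-∀

    memory-block : memory blockAlgorithm ℕ.≤ suc L
    memory-block = ℕ.≤-trans (memory-tournament s offset tournament _) (space-partial k L i)

  algorithm : Algorithm n
  algorithm = random q (blockAlgorithm ∘ block)

  tosses-algorithm : suc q ℕ.* tosses algorithm ℕ.≤ 12 ℕ.* s ℕ.* k ℕ.* n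
  tosses-algorithm = begin
    suc q ℕ.* tosses algorithm             ≤⟨ ℕ.*-monoʳ-≤ (suc q)
                                                  (foldr-⊔-lub (tosses-block ∘ block)) ⟩
    suc q ℕ.* (12 ℕ.* s ℕ.* k ℕ.* i₀)      ≡⟨ regroup (suc q) (12 ℕ.* s ℕ.* k) i₀ ⟩
    12 ℕ.* s ℕ.* k ℕ.* (suc q ℕ.* i₀)      ≤⟨ ℕ.*-monoʳ-≤ (12 ℕ.* s ℕ.* k) i₀*q≤n ⟩
    12 ℕ.* s ℕ.* k ℕ.* n                   ∎
    where
    open ℕ.≤-Reasoning
    regroup : ∀ q a i → q ℕ.* (a ℕ.* i) ≡ a ℕ.* (q ℕ.* i)
    regroup = solve-∀

  memory-algorithm : memory algorithm ℕ.≤ suc L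
  memory-algorithm = ℕ.⊔-lub
    (ℕ.≤-trans (ℕ.≤-reflexive (∣⊥∣≡0 n)) ℕ.z≤n) (foldr-⊔-lub (memory-block ∘ block))

  module _ {c ℓ₁ ℓ₂} (R : Reals c ℓ₁ ℓ₂) where
    open Reals R hiding (zero)
    open RealProperties R
    open OrderedField R
    open CoinTossing R
    open ErrorBounds R
    open Success R

    success-algorithm : ∀ {p : Biases n} → IsBiases p → ∀ {b} → Separates s p b →
      1# ≤ fromℕ (suc q) * Pr[ algorithm outputs b ∣ p ] + ½ ^ k
    success-algorithm isBiases {b} sep with find-block (toℕ b) (ℕ.s≤s⁻¹ (toℕ<n b))
    ... | J , offset≤b , b<end = succeeds-random isBiases b q {P = blockAlgorithm ∘ block} J
      (succeeds-tournament isBiases b sep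
        (error-mono (levelError≤ k L) (error-partial k L (i<capacity B)))
        (≡.subst (ℕ._≤ toℕ b) (≡.sym (ℕ.+-identityʳ _)) offset≤b)
        (≡.subst (toℕ b ℕ.<_) (≡.sym (finish-tournament B)) b<end))
      where B = block J

-- Choosing the number of blocks and the error exponent from δ

module Confidence {c ℓ₁ ℓ₂} (R : Reals c ℓ₁ ℓ₂) where
  open Reals R hiding (zero)
  open RealProperties R
  open OrderedField R
  open Logarithm R
  open Separation R
  open LogBounds R
  open ≤-Reasoning
  open S using (_:*_; _:=_)

  module _ {δ : ℝ} (0<δ : 0# < δ) (δ<1 : δ < 1#) where

    private
      log ε : ℝ
      log = log1/ 0<δ δ<1
      ε   = 1# - δ

      0<ε : 0# < ε
      0<ε = x<y⇒0<y-x δ<1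

      ε≤log : ε ≤ log
      ε≤log = 1-δ≤log1/ 0<δ δ<1

      ½^-< : ∀ i → ½ ^ suc i < ½ ^ i
      ½^-< i = <-respʳ-≈ (½^-double i) (x<x+y (^-pos 0<½ (suc i)))

      4*½²≈1 : fromℕ 4 * (½ * ½) ≈ 1#
      4*½²≈1 = trans (*-congˡ (*-congˡ (sym (*-identityʳ ½)))) (2^n*½^n≈1 2)

    -- Playing only one of `q + 1` blocks divides both the tosses and the guaranteed success by
    -- `q + 1`; `cheap` and `reliable` are what the two sides of this trade-off have to satisfy.
    record Parameters : Set (c l⊔ ℓ₂) where
      field
        q k      : ℕ
        1≤k      : 1 ℕ.≤ k
        cheap    : fromℕ k ≤ fromℕ 16 * (fromℕ (suc q) * log)
        reliable : ∀ {π} → 1# ≤ fromℕ (suc q) * π + ½ ^ k → ε ≤ π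

    -- The bounds differ by the factor 4 rather than 2, to leave cotransitivity the room between two
    -- consecutive powers.
    dyadic : ∃[ i ] (δ < ½ ^ i × ½ ^ suc (suc i) < δ)
    dyadic = least-switch {P = λ i → δ < ½ ^ i} {Q = λ i → ½ ^ suc i < δ}
      δ<1 (λ i → <-cotrans (½^-< (suc i)) δ) N ½^N≤δ
      where
      N = proj₁ (archimedean (inv δ 0<δ))
      ½^N≤δ : ½ ^ N ≤ δ
      ½^N≤δ δ<½^N = <-irrefl refl (begin-strict
        1#                         ≈⟨ *-inverseʳ δ 0<δ ⟨
        δ * inv δ 0<δ              <⟨ *-monoʳ-< 0<δ (proj₂ (archimedean (inv δ 0<δ))) ⟩
        δ * fromℕ N                ≤⟨ *-mono-≤ (0≤fromℕ N) (0≤½^ N) (<⇒≤ δ<½^N)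
                                          (fromℕ-mono-≤ (ℕ.<⇒≤ (n<2^n N))) ⟩
        ½ ^ N * fromℕ (2 ℕ.^ N)    ≈⟨ trans (*-comm _ _) (2^n*½^n≈1 N) ⟩
        1#                         ∎)
        where
        n<2^n : ∀ n → n ℕ.< 2 ℕ.^ n
        n<2^n zero    = ℕ.≤-refl
        n<2^n (suc n) = ℕ.+-mono-≤ (ℕ.≤-trans (ℕ.s≤s ℕ.z≤n) (n<2^n n))
          (ℕ.≤-trans (n<2^n n) (ℕ.≤-reflexive (≡.sym (ℕ.+-identityʳ _))))

    -- If δ is bounded away from 1, all coins take part.
    all-coins : ½ ^ 3 < ε → Parameters
    all-coins ⅛<ε = from dyadic
      where
      cheap : ∀ i → δ < ½ ^ i → fromℕ (2 ℕ.+ i) ≤ fromℕ 16 * log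
      -- Here `δ < 1` carries no information, but `log` is at least `ε`, which exceeds 1/8. This
      -- case determines the constant 16.
      cheap zero    _   = begin
        fromℕ 2                            ≈⟨ *-identityʳ _ ⟨
        fromℕ 2 * 1#                       ≈⟨ *-congˡ (2^n*½^n≈1 3) ⟨
        fromℕ 2 * (fromℕ 8 * ½ ^ 3)        ≈⟨ *-assoc _ _ _ ⟨
        fromℕ 2 * fromℕ 8 * ½ ^ 3          ≈⟨ *-congʳ (fromℕ-* 2 8) ⟨
        fromℕ 16 * ½ ^ 3                   ≤⟨ *-monoʳ-≤′ (0≤fromℕ 16) (≤-trans (<⇒≤ ⅛<ε) ε≤log) ⟩
        fromℕ 16 * log                     ∎
      cheap (suc a) δ<  = begin
        fromℕ (3 ℕ.+ a)                              ≤⟨ fromℕ-mono-≤ (3+a≤ a) ⟩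
        fromℕ (4 ℕ.* suc a)                          ≈⟨ fromℕ-* 4 (suc a) ⟩
        fromℕ 4 * A                                  ≈⟨ *-congˡ (*-identityʳ A) ⟨
        fromℕ 4 * (A * 1#)                           ≈⟨ *-congˡ (*-congˡ 4*½²≈1) ⟨
        fromℕ 4 * (A * (fromℕ 4 * (½ * ½)))          ≈⟨ S.solve 3 (λ f A h →
          f :* (A :* (f :* h)) := f :* f :* (A :* h)) refl (fromℕ 4) A (½ * ½) ⟩
        fromℕ 4 * fromℕ 4 * (A * (½ * ½))            ≤⟨ *-mono-≤
          (0≤* (0≤fromℕ (suc a)) (<⇒≤ (*-pos 0<½ 0<½)))
          (0≤fromℕ 16) (≤-reflexive (sym (fromℕ-* 4 4))) (log1/-lower 0<δ δ<1 a (<⇒≤ δ<)) ⟩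
        fromℕ 16 * log                               ∎
        where
        A = fromℕ (suc a)
        3+a≤ : ∀ a → 3 ℕ.+ a ℕ.≤ 4 ℕ.* suc a
        3+a≤ a = ≡.subst (3 ℕ.+ a ℕ.≤_) (regroup a) (ℕ.m≤m+n (3 ℕ.+ a) (1 ℕ.+ 3 ℕ.* a))
          where
          regroup : ∀ a → 3 ℕ.+ a ℕ.+ (1 ℕ.+ 3 ℕ.* a) ≡ 4 ℕ.* suc a
          regroup = solve-∀
      1*x≈x : ∀ x → fromℕ 1 * x ≈ x
      1*x≈x x = trans (*-congʳ (+-identityʳ 1#)) (*-identityˡ x)
      from : ∃[ i ] (δ < ½ ^ i × ½ ^ suc (suc i) < δ) → Parameters
      from (i , δ< , <δ) = record
        { q = 0 ; k = 2 ℕ.+ i ; 1≤k = ℕ.s≤s ℕ.z≤n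
        ; cheap    = ≤-resp refl (*-congˡ (sym (1*x≈x log))) (cheap i δ<)
        ; reliable = λ {π} 1≤ → +-cancelˡ-≤ δ (begin
            δ + ε                           ≈⟨ x+[y-x]≈y δ 1# ⟩
            1#                              ≤⟨ 1≤ ⟩
            fromℕ 1 * π + ½ ^ (2 ℕ.+ i)     ≤⟨ +-mono-≤ (≤-reflexive (1*x≈x π)) (<⇒≤ <δ) ⟩
            π + δ                           ≈⟨ +-comm π δ ⟩
            δ + π                           ∎)
        }

    -- If the required probability of success is a small ε, then it suffices to let
    -- a fraction of order ε of the coins take part.
    some-coins : ε < ½ ^ 2 → Parameters
    some-coins ε<¼ = from (multiple-between 0<ε 0<½ ¼<½)
      where
      ¼<½ : ½ ^ 2 < ½
      ¼<½ = <-respʳ-≈ (*-identityʳ ½) (½^-< 1)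
      from : ∃[ N ] (fromℕ N * ε < ½ × ½ ^ 2 < fromℕ (suc N) * ε) → Parameters
      from (zero  , _   , ¼<) = contradiction
        (<-respʳ-≈ (trans (*-congʳ (+-identityʳ 1#)) (*-identityˡ ε)) ¼<) (<⇒≤ ε<¼)
      -- The block of the best coin is chosen with probability `1 / (q + 1)` and then succeeds with
      -- probability at least `½`; `(q + 1) ε < ½` makes this enough. Conversely `¼ < (q + 2) ε`
      -- ensures that there are enough blocks for the budget.
      from (suc q , qε< , ¼<) = record
        { q = q ; k = 1 ; 1≤k = ℕ.≤-refl
        ; cheap    = begin
            fromℕ 1                             ≈⟨ +-identityʳ 1# ⟩
            1#                                  ≈⟨ 2^n*½^n≈1 2 ⟨
            fromℕ 4 * ½ ^ 2                     ≤⟨ *-monoʳ-≤′ (0≤fromℕ 4) (<⇒≤ ¼<) ⟩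
            fromℕ 4 * (fromℕ (2 ℕ.+ q) * ε)     ≈⟨ *-assoc _ _ ε ⟨
            fromℕ 4 * fromℕ (2 ℕ.+ q) * ε       ≈⟨ *-congʳ (fromℕ-* 4 (2 ℕ.+ q)) ⟨
            fromℕ (4 ℕ.* (2 ℕ.+ q)) * ε         ≤⟨ *-mono-≤ (<⇒≤ 0<ε)
              (0≤fromℕ (16 ℕ.* suc q)) (fromℕ-mono-≤ (8+4q≤ q)) ε≤log ⟩
            fromℕ (16 ℕ.* suc q) * log          ≈⟨ *-congʳ (fromℕ-* 16 (suc q)) ⟩
            fromℕ 16 * fromℕ (suc q) * log      ≈⟨ *-assoc _ _ log ⟩
            fromℕ 16 * (fromℕ (suc q) * log)    ∎
        ; reliable = λ {π} 1≤ → *-cancelˡ-≤ (0<fromℕ-suc q) (≤-trans (<⇒≤ qε<)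
            (+-cancelˡ-≤ ½ (begin
              ½ + ½                        ≈⟨ ½+½≈1 ⟩
              1#                           ≤⟨ 1≤ ⟩
              fromℕ (suc q) * π + ½ ^ 1    ≈⟨ trans (+-congˡ (*-identityʳ ½)) (+-comm _ ½) ⟩
              ½ + fromℕ (suc q) * π        ∎)))
        }
        where
        8+4q≤ : ∀ q → 4 ℕ.* (2 ℕ.+ q) ℕ.≤ 16 ℕ.* suc q
        8+4q≤ q = ≡.subst (4 ℕ.* (2 ℕ.+ q) ℕ.≤_) (regroup q)
          (ℕ.m≤m+n (4 ℕ.* (2 ℕ.+ q)) (8 ℕ.+ 12 ℕ.* q))
          where
          regroup : ∀ q → 4 ℕ.* (2 ℕ.+ q) ℕ.+ (8 ℕ.+ 12 ℕ.* q) ≡ 16 ℕ.* suc q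
          regroup = solve-∀

    parameters : Parameters
    parameters with <-cotrans (½^-< 2) ε
    ... | inj₁ ⅛<ε = all-coins ⅛<ε
    ... | inj₂ ε<¼ = some-coins ε<¼

propositionA6 : ∀ {c ℓ₁ ℓ₂} (R : Reals c ℓ₁ ℓ₂) →
    let open Reals R
        open Logarithm R
        open CoinTossing R
    in
    ∃[ C ] (∀ (n : ℕ) → 2 ℕ.≤ n →
      ∀ (Δ δ : ℝ) (0<Δ : 0# < Δ) (0<δ : 0# < δ) (δ<1 : δ < 1#) →
      Σ[ A ∈ Algorithm n ]
        ( (∀ (p : Biases n) → IsBiases p → (g : HasGap p Δ) →
             1# - δ ≤ Pr[ A outputs HasGap.best g ∣ p ])
        × fromℕ (tosses A) ≤
             fromℕ C * (fromℕ n * inv (Δ * Δ) (*-pos 0<Δ 0<Δ) * log1/ 0<δ δ<1)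
        × memory A ℕ.≤ C ℕ.* (1 ⊔ ⌊log₂ ⌊log₂ n ⌋ ⌋)))
propositionA6 R = C , λ where
    (suc n′) _ Δ δ 0<Δ 0<δ δ<1 → construct n′ 0<Δ 0<δ δ<1
  where
  open Reals R hiding (zero)
  open RealProperties R
  open OrderedField R
  open Logarithm R
  open CoinTossing R
  open Separation R
  open Confidence R
  open ≤-Reasoning
  open S using (_:*_; _:=_)

  -- The factor 12 is two tosses per round times `rate ≤ 6 * k`, 24 bounds `s Δ²`, and 16 comes from
  -- `cheap`.
  C : ℕ
  C = 12 ℕ.* 24 ℕ.* 16

  module _ (n′ : ℕ) {Δ δ : ℝ} (0<Δ : 0# < Δ) (0<δ : 0# < δ) (δ<1 : δ < 1#) where

    open Parameters (parameters 0<δ δ<1)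

    s : ℕ
    s = proj₁ (enough-rounds 0<Δ)

    open RandomBlock n′ q k s (levels (suc n′)) 1≤k (n<capacity-levels (suc n′))

    private
      log Δ⁻² N Q 𝐬 𝐤 : ℝ
      log = log1/ 0<δ δ<1
      Δ⁻² = inv (Δ * Δ) (*-pos 0<Δ 0<Δ)
      N   = fromℕ n
      Q   = fromℕ (suc q)
      𝐬   = fromℕ s
      𝐤   = fromℕ k

    0≤Δ⁻² : 0# ≤ Δ⁻²
    0≤Δ⁻² = <⇒≤ (inv-pos (Δ * Δ) (*-pos 0<Δ 0<Δ))

    s≤24Δ⁻² : 𝐬 ≤ fromℕ 24 * Δ⁻²
    s≤24Δ⁻² = begin
      𝐬                     ≈⟨ *-identityʳ 𝐬 ⟨
      𝐬 * 1#                ≈⟨ *-congˡ (*-inverseʳ (Δ * Δ) _) ⟨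
      𝐬 * (Δ * Δ * Δ⁻²)     ≈⟨ *-assoc 𝐬 (Δ * Δ) Δ⁻² ⟨
      𝐬 * (Δ * Δ) * Δ⁻²     ≤⟨ *-monoˡ-≤′ 0≤Δ⁻² (proj₁ (proj₂ (enough-rounds 0<Δ))) ⟩
      fromℕ 24 * Δ⁻²        ∎

    tosses-bound : fromℕ (tosses algorithm) ≤ fromℕ C * (N * Δ⁻² * log)
    tosses-bound = *-cancelˡ-≤ (0<fromℕ-suc q) (begin
      Q * fromℕ (tosses algorithm)
        ≈⟨ fromℕ-* (suc q) (tosses algorithm) ⟨
      fromℕ (suc q ℕ.* tosses algorithm)
        ≤⟨ fromℕ-mono-≤ tosses-algorithm ⟩
      fromℕ (12 ℕ.* s ℕ.* k ℕ.* n)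
        ≈⟨ trans (fromℕ-* (12 ℕ.* s ℕ.* k) n)
             (*-congʳ (trans (fromℕ-* (12 ℕ.* s) k) (*-congʳ (fromℕ-* 12 s)))) ⟩
      fromℕ 12 * 𝐬 * 𝐤 * N
        ≤⟨ *-monoˡ-≤′ (0≤fromℕ n) (*-mono-≤ (0≤fromℕ k)
             (0≤* (0≤fromℕ 12) (0≤* (0≤fromℕ 24) 0≤Δ⁻²))
             (*-monoʳ-≤′ (0≤fromℕ 12) s≤24Δ⁻²) cheap) ⟩
      fromℕ 12 * (fromℕ 24 * Δ⁻²) * (fromℕ 16 * (Q * log)) * N
        ≈⟨ S.solve 7 (λ a b c i q l n → a :* (b :* i) :* (c :* (q :* l)) :* n :=
             q :* (a :* b :* c :* (n :* i :* l))) refl (fromℕ 12) (fromℕ 24) (fromℕ 16) Δ⁻² Q log N ⟩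
      Q * (fromℕ 12 * fromℕ 24 * fromℕ 16 * (N * Δ⁻² * log))
        ≈⟨ *-congˡ (*-congʳ (trans (fromℕ-* (12 ℕ.* 24) 16) (*-congʳ (fromℕ-* 12 24)))) ⟨
      Q * (fromℕ C * (N * Δ⁻² * log)) ∎)

    construct : Σ[ A ∈ Algorithm n ]
      ( (∀ (p : Biases n) → IsBiases p → (g : HasGap p Δ) →
           1# - δ ≤ Pr[ A outputs HasGap.best g ∣ p ])
      × fromℕ (tosses A) ≤ fromℕ C * (N * Δ⁻² * log)
      × memory A ℕ.≤ C ℕ.* (1 ⊔ ⌊log₂ ⌊log₂ n ⌋ ⌋))
    construct = algorithm
      , (λ p isBiases g → reliable (success-algorithm R isBiases
          (separates 0<Δ isBiases g (proj₂ (proj₂ (enough-rounds 0<Δ)) (gap≤1 0<Δ isBiases g)))))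
      , tosses-bound
      , ℕ.≤-trans memory-algorithm (ℕ.≤-trans (1+levels≤ n)
          (ℕ.*-monoˡ-≤ (1 ⊔ ⌊log₂ ⌊log₂ n ⌋ ⌋) (ℕ.m≤m+n 4 (C ℕ.∸ 4))))
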